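{- Let $p>3$ be a prime. Then, in the polynomial ring $\mathbb Z_p[x]$ (congruences meaning coefficientwise congruence), $$\sum_{k=0}^{p-1}\frac{\binom{3k}k\binom{2k}k}{27^k}\left(x^k-\left(\frac p3\right)(1-x)^k\right)\equiv0\pmod{p^2},$$ $$\sum_{k=0}^{p-1}\frac{\binom{4k}{2k}\binom{2k}k}{64^k}\left(x^k-\left(\frac { -2}p\right)(1-x)^k\right)\equiv0\pmod{p^2},$$ $$\sum_{k=0}^{p-1}\frac{\binom{6k}{3k}\binom{3k}k}{432^k}\left(x^k-\left(\frac { -1}p\right)(1-x)^k\right)\equiv0\pmod{p^2}.$$ Also, $$\sum_{k=1}^{p-1}\frac{k\binom{3k}k\binom{2k}k}{27^k}\left(x^{k-1}+\left(\frac p3\right)(1-x)^{k-1}\right)\equiv0\pmod{p^2},$$ $$\sum_{k=1}^{p-1}\frac{k\binom{4k}{2k}\binom{2k}k}{64^k}\left(x^{k-1}+\left(\frac { -2}p\right)(1-x)^{k-1}\right)\equiv0\pmod{p^2},$$ $$\sum_{k=1}^{p-1}\frac{k\binom{6k}{3k}\binom{3k}k}{432^k}\left(x^{k-1}+\left(\frac { -1}p\right)(1-x)^{k-1}\right)\equiv0\pmod{p^2}.$$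
   Context: $\mathbb Z_p$ denotes the ring of $p$-adic integers; $\left(\frac{\cdot}{p}\right)$ is the Legendre symbol and $\left(\frac{p}{3}\right)$ the Legendre symbol modulo $3$. -}

module Defs where

open import Data.Nat as ℕ using (ℕ; zero; suc; NonZero; _^_; _∸_)
open import Data.Nat.Properties using (m^n≢0)
open import Data.Nat.Divisibility using (_∣_)
open import Data.Nat.Combinatorics using (_C_)
open import Data.Integer as ℤ using (ℤ; +_; _%ℕ_)
open import Data.Rational as ℚ using (ℚ; _/_; 0ℚ; 1ℚ)
open import Data.List using (List; []; _∷_; upTo)
open import Data.Bool.ListAction using (any)
open import Data.List.Relation.Unary.All using (All)
open import Data.Bool using (Bool; true; false; if_then_else_)
open import Data.Product using (Σ; _×_)
open import Relation.Nullary using (¬_)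
open import Relation.Binary.PropositionalEquality using (_≡_)

-- Legendre symbol (a / p): 0 if p ∣ a, 1 if a is a nonzero square mod p,
-- -1 otherwise.  (For p = 0 we return 0; it is only used at primes.)

legendre : ℤ → ℕ → ℤ
legendre a zero = + 0
legendre a (suc n) with a %ℕ suc n
... | zero = + 0
... | r@(suc _) =
  if any (λ x → ((x ℕ.* x) ℕ.% suc n) ℕ.≡ᵇ r) (upTo (suc n))
  then + 1 else ℤ.- (+ 1)

-- Polynomials over ℚ as coefficient lists (constant term first).

Poly : Set
Poly = List ℚ

padd : Poly → Poly → Poly
padd [] q = q
padd (a ∷ p) [] = a ∷ p
padd (a ∷ p) (b ∷ q) = (a ℚ.+ b) ∷ padd p q

pscale : ℚ → Poly → Poly
pscale c [] = []
pscale c (a ∷ p) = (c ℚ.* a) ∷ pscale c p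

pmul : Poly → Poly → Poly
pmul [] q = []
pmul (a ∷ p) q = padd (pscale a q) (0ℚ ∷ pmul p q)

ppow : Poly → ℕ → Poly
ppow q zero = 1ℚ ∷ []
ppow q (suc n) = pmul q (ppow q n)

X : Poly
X = 0ℚ ∷ 1ℚ ∷ []

1-X : Poly
1-X = 1ℚ ∷ ℚ.- 1ℚ ∷ []

psum : (ℕ → Poly) → ℕ → Poly
psum f zero = []
psum f (suc n) = padd (psum f n) (f n)

-- Congruence mod p^2 in ℤ_p (for rationals whose denominators are prime
-- to p, i.e. elements of ℤ_(p) ⊂ ℤ_p): c ≡ 0 (mod p²) iff c = a p² / b
-- with a ∈ ℤ, b ∈ ℕ, p ∤ b.

ZeroModP² : ℕ → ℚ → Set
ZeroModP² p c =
  Σ ℤ λ a → Σ ℕ λ b → Σ (NonZero b) λ nz →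
    ¬ (p ∣ b) × (c ≡ _/_ (a ℤ.* + (p ^ 2)) b {{nz}})

PolyZeroModP² : ℕ → Poly → Set
PolyZeroModP² p P = All (ZeroModP² p) P

ℤtoℚ : ℤ → ℚ
ℤtoℚ z = z / 1

frac : ℕ → (m : ℕ) → .{{NonZero m}} → ℕ → ℚ
frac n m k = _/_ (+ n) (m ^ k) {{m^n≢0 m k}}

a₁ a₂ a₃ : ℕ → ℚ
a₁ k = frac (((3 ℕ.* k) C k) ℕ.* ((2 ℕ.* k) C k)) 27 k
a₂ k = frac (((4 ℕ.* k) C (2 ℕ.* k)) ℕ.* ((2 ℕ.* k) C k)) 64 k
a₃ k = frac (((6 ℕ.* k) C (3 ℕ.* k)) ℕ.* ((3 ℕ.* k) C k)) 432 k

S⁻ : (ℕ → ℚ) → ℚ → ℕ → Poly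
S⁻ a ε p = psum (λ k → pscale (a k)
                 (padd (ppow X k) (pscale (ℚ.- ε) (ppow 1-X k)))) p

-- Σ_{k=1}^{p-1} k a k (x^{k-1} + ε (1-x)^{k-1})   (k = j+1, j < p-1)
S⁺ : (ℕ → ℚ) → ℚ → ℕ → Poly
S⁺ a ε p = psum (λ j → pscale (ℤtoℚ (+ suc j) ℚ.* a (suc j))
                 (padd (ppow X j) (pscale ε (ppow 1-X j)))) (p ∸ 1)

{-# OPTIONS --safe #-}

-- Each coefficient sequence is Aₖ/mᵏ with m = d²e (d = 3, 4, 6) and
-- (k+1)² Aₖ₊₁ = e R(k) Aₖ, where R(k) = d²k(k+1) + d - 1 = (dk+1)(dk+d-1).  Hence the integers
-- Bₖ = Aₖ mᵖ⁻ᵏ satisfy d²(k+1)² Bₖ₊₁ = R(k) Bₖ for k < p, which expresses a hypergeometric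
-- differential equation for f(x) = Σ_{k<p} Bₖxᵏ that is invariant under x ↦ 1 - x.  The truncation
-- at p costs a boundary term d²p²B_p, so f(1-x) satisfies the same equation modulo p², and
-- therefore B₀ f(1-x) ≡ f(1) f(x) (mod p²).  Setting x = 1 gives f(1)² ≡ B₀².  For q = ⌊p/d⌋ we
-- have p ∣ R(q) and p ∤ R(k) for k < q, so modulo p the polynomial f has degree q, and comparing
-- leading coefficients gives f(1) ≡ (-1)^q B₀ modulo p, hence modulo p².  Thus
-- f(1-x) ≡ (-1)^q f(x) (mod p²); the second group of congruences is its formal derivative.
-- Finally (-1)^q is the stated Legendre symbol: for d = 3 by parity, for d = 4, 6 by Euler's
-- criterion and Gauss's evaluation of (-2)^((p-1)/2).

module Submission where

open import Defs

-- Recurrences for the integer numerators of the three families.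

module Numerators where

  open import Data.Nat
  open import Data.Nat.Properties
  open import Data.Nat.Combinatorics using (_C_; k![n∸k]!∣n!)
  open import Data.Nat.Combinatorics.Specification using (nCk≡n!/k![n-k]!)
  open import Data.Nat.DivMod using (m/n*n≡m)
  open import Data.Nat.Tactic.RingSolver using (solve-∀)
  open import Relation.Binary.PropositionalEquality

  C-factorial : ∀ {n} a b → n ≡ a + b → (n C a) * (a ! * b !) ≡ n !
  C-factorial a b refl = begin
    ((a + b) C a) * (a ! * b !)
      ≡⟨ cong (λ c → ((a + b) C a) * (a ! * c !)) (m+n∸m≡n a b) ⟨
    ((a + b) C a) * (a ! * (a + b ∸ a) !)
      ≡⟨ cong (_* (a ! * (a + b ∸ a) !)) (nCk≡n!/k![n-k]! a≤a+b) ⟩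
    (a + b) ! / (a ! * (a + b ∸ a) !) * (a ! * (a + b ∸ a) !) ≡⟨ m/n*n≡m (k![n∸k]!∣n! a≤a+b) ⟩
    (a + b) ! ∎
    where
    open ≡-Reasoning
    a≤a+b = m≤m+n a b
    instance _ = a !* (a + b ∸ a) !≢0

  -- A k is the quotient N k / D k, and X k cancels in the ratio of consecutive quotients.
  quotient-recurrence : ∀ (A D N X ρ : ℕ → ℕ) →
    (∀ k → A k * D k ≡ N k) →
    (∀ k → D (suc k) ≡ X k * ((1 + k) * (1 + k)) * D k) →
    (∀ k → N (suc k) ≡ X k * ρ k * N k) →
    (∀ k → NonZero (X k * D k)) →
    ∀ k → A (suc k) * ((1 + k) * (1 + k)) ≡ ρ k * A k
  quotient-recurrence A D N X ρ AD≡N D-suc N-suc XD≢0 k =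
    *-cancelʳ-≡ _ _ (X k * D k) {{XD≢0 k}} (begin
      A (suc k) * ((1 + k) * (1 + k)) * (X k * D k)
        ≡⟨ lemma (A (suc k)) ((1 + k) * (1 + k)) (X k) (D k) ⟩
      A (suc k) * (X k * ((1 + k) * (1 + k)) * D k) ≡⟨ cong (A (suc k) *_) (D-suc k) ⟨
      A (suc k) * D (suc k)                         ≡⟨ AD≡N (suc k) ⟩
      N (suc k)                                     ≡⟨ N-suc k ⟩
      X k * ρ k * N k                               ≡⟨ cong (X k * ρ k *_) (AD≡N k) ⟨
      X k * ρ k * (A k * D k)                       ≡⟨ lemma₂ (X k) (ρ k) (A k) (D k) ⟩
      ρ k * A k * (X k * D k)                       ∎)
    where
    open ≡-Reasoning
    lemma : ∀ a b c d → a * b * (c * d) ≡ a * (c * b * d)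
    lemma = solve-∀
    lemma₂ : ∀ a b c d → a * b * (c * d) ≡ b * c * (a * d)
    lemma₂ = solve-∀

  A₁ A₂ A₃ : ℕ → ℕ
  A₁ k = ((3 * k) C k) * ((2 * k) C k)
  A₂ k = ((4 * k) C (2 * k)) * ((2 * k) C k)
  A₃ k = ((6 * k) C (3 * k)) * ((3 * k) C k)

  A₁-factorial : ∀ k → A₁ k * (k ! * (k ! * k !)) ≡ (3 * k) !
  A₁-factorial k = begin
    ((3 * k) C k) * ((2 * k) C k) * (k ! * (k ! * k !))   ≡⟨ lemma ((3 * k) C k) ((2 * k) C k) (k !) ⟩
    ((3 * k) C k) * (k ! * (((2 * k) C k) * (k ! * k !)))
      ≡⟨ cong (λ z → ((3 * k) C k) * (k ! * z)) (C-factorial k k (double k)) ⟩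
    ((3 * k) C k) * (k ! * (2 * k) !)                     ≡⟨ C-factorial k (2 * k) refl ⟩
    (3 * k) !                                             ∎
    where
    open ≡-Reasoning
    double : ∀ k → 2 * k ≡ k + k
    double = solve-∀
    lemma : ∀ a b c → a * b * (c * (c * c)) ≡ a * (c * (b * (c * c)))
    lemma = solve-∀

  A₂-factorial : ∀ k → A₂ k * ((2 * k) ! * (k ! * k !)) ≡ (4 * k) !
  A₂-factorial k = begin
    ((4 * k) C (2 * k)) * ((2 * k) C k) * ((2 * k) ! * (k ! * k !))
      ≡⟨ lemma ((4 * k) C (2 * k)) ((2 * k) C k) ((2 * k) !) (k !) ⟩
    ((4 * k) C (2 * k)) * ((2 * k) ! * (((2 * k) C k) * (k ! * k !)))
      ≡⟨ cong (λ z → ((4 * k) C (2 * k)) * ((2 * k) ! * z)) (C-factorial k k (double k)) ⟩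
    ((4 * k) C (2 * k)) * ((2 * k) ! * (2 * k) !)
      ≡⟨ C-factorial (2 * k) (2 * k) (quadruple k) ⟩
    (4 * k) !                                             ∎
    where
    open ≡-Reasoning
    double : ∀ k → 2 * k ≡ k + k
    double = solve-∀
    quadruple : ∀ k → 4 * k ≡ 2 * k + 2 * k
    quadruple = solve-∀
    lemma : ∀ a b c d → a * b * (c * (d * d)) ≡ a * (c * (b * (d * d)))
    lemma = solve-∀

  A₃-factorial : ∀ k → A₃ k * ((3 * k) ! * (k ! * (2 * k) !)) ≡ (6 * k) !
  A₃-factorial k = begin
    ((6 * k) C (3 * k)) * ((3 * k) C k) * ((3 * k) ! * (k ! * (2 * k) !))
      ≡⟨ lemma ((6 * k) C (3 * k)) ((3 * k) C k) ((3 * k) !) (k !) ((2 * k) !) ⟩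
    ((6 * k) C (3 * k)) * ((3 * k) ! * (((3 * k) C k) * (k ! * (2 * k) !)))
      ≡⟨ cong (λ z → ((6 * k) C (3 * k)) * ((3 * k) ! * z)) (C-factorial k (2 * k) refl) ⟩
    ((6 * k) C (3 * k)) * ((3 * k) ! * (3 * k) !)
      ≡⟨ C-factorial (3 * k) (3 * k) (sextuple k) ⟩
    (6 * k) !                                             ∎
    where
    open ≡-Reasoning
    sextuple : ∀ k → 6 * k ≡ 3 * k + 3 * k
    sextuple = solve-∀
    lemma : ∀ a b c d e → a * b * (c * (d * e)) ≡ a * (c * (b * (d * e)))
    lemma = solve-∀

  2k-factorial : ∀ k → (2 * suc k) ! ≡ (2 + 2 * k) * (1 + 2 * k) * (2 * k) !
  2k-factorial k = trans (cong _! (*-suc 2 k)) (lemma (2 * k) ((2 * k) !))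
    where
    lemma : ∀ n f → (2 + n) * ((1 + n) * f) ≡ (2 + n) * (1 + n) * f
    lemma = solve-∀

  3k-factorial : ∀ k → (3 * suc k) ! ≡ (3 + 3 * k) * (2 + 3 * k) * (1 + 3 * k) * (3 * k) !
  3k-factorial k = trans (cong _! (*-suc 3 k)) (lemma (3 * k) ((3 * k) !))
    where
    lemma : ∀ n f → (3 + n) * ((2 + n) * ((1 + n) * f)) ≡ (3 + n) * (2 + n) * (1 + n) * f
    lemma = solve-∀

  -- From k to k + 1, (3k)! gains (3k+3)(3k+2)(3k+1) and k!³ gains (k+1)³; a factor k + 1 cancels,
  -- and (3k+1)(3k+2) = 9k(k+1) + 2.
  A₁-recurrence : ∀ k → A₁ (suc k) * ((1 + k) * (1 + k)) ≡ 3 * (9 * (k * (1 + k)) + 2) * A₁ k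
  A₁-recurrence = quotient-recurrence A₁ (λ k → k ! * (k ! * k !)) (λ k → (3 * k) !) suc
    (λ k → 3 * (9 * (k * (1 + k)) + 2)) A₁-factorial (λ k → lemma (1 + k) (k !))
    (λ k → trans (3k-factorial k) (lemma₂ k ((3 * k) !)))
    (λ k → m*n≢0 (suc k) _ {{_}} {{m*n≢0 _ _ {{k !≢0}} {{k !* k !≢0}}}})
    where
    lemma : ∀ k f → k * f * (k * f * (k * f)) ≡ k * (k * k) * (f * (f * f))
    lemma = solve-∀
    lemma₂ : ∀ k f → (3 + 3 * k) * (2 + 3 * k) * (1 + 3 * k) * f ≡ (1 + k) * (3 * (9 * (k * (1 + k)) + 2)) * f
    lemma₂ = solve-∀

  A₂-recurrence : ∀ k → A₂ (suc k) * ((1 + k) * (1 + k)) ≡ 4 * (16 * (k * (1 + k)) + 3) * A₂ k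
  A₂-recurrence = quotient-recurrence A₂ (λ k → (2 * k) ! * (k ! * k !)) (λ k → (4 * k) !)
    (λ k → (2 + 2 * k) * (1 + 2 * k)) (λ k → 4 * (16 * (k * (1 + k)) + 3)) A₂-factorial
    (λ k → trans (cong (_* (suc k ! * suc k !)) (2k-factorial k)) (lemma k ((2 * k) !) (k !)))
    (λ k → trans (cong _! (*-suc 4 k)) (lemma₂ k ((4 * k) !)))
    (λ k → m*n≢0 ((2 + 2 * k) * (1 + 2 * k)) _ {{_}} {{m*n≢0 _ _ {{(2 * k) !≢0}} {{k !* k !≢0}}}})
    where
    lemma : ∀ k g f → (2 + 2 * k) * (1 + 2 * k) * g * ((1 + k) * f * ((1 + k) * f))
      ≡ (2 + 2 * k) * (1 + 2 * k) * ((1 + k) * (1 + k)) * (g * (f * f))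
    lemma = solve-∀
    lemma₂ : ∀ k f → (4 + 4 * k) * ((3 + 4 * k) * ((2 + 4 * k) * ((1 + 4 * k) * f)))
      ≡ (2 + 2 * k) * (1 + 2 * k) * (4 * (16 * (k * (1 + k)) + 3)) * f
    lemma₂ = solve-∀

  A₃-recurrence : ∀ k → A₃ (suc k) * ((1 + k) * (1 + k)) ≡ 12 * (36 * (k * (1 + k)) + 5) * A₃ k
  A₃-recurrence = quotient-recurrence A₃ (λ k → (3 * k) ! * (k ! * (2 * k) !)) (λ k → (6 * k) !)
    -- The part common to both ratios: (k+1)(2k+2)(2k+1) = (4k+2)(k+1)² below, and above only
    -- 12(6k+1)(6k+5) remains.
    (λ k → (3 + 3 * k) * (2 + 3 * k) * (1 + 3 * k) * (2 + 4 * k))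
    (λ k → 12 * (36 * (k * (1 + k)) + 5)) A₃-factorial
    (λ k → trans (cong₂ (λ a b → a * ((suc k !) * b)) (3k-factorial k) (2k-factorial k))
      (lemma k ((3 * k) !) (k !) ((2 * k) !)))
    (λ k → trans (cong _! (*-suc 6 k)) (lemma₂ k ((6 * k) !)))
    (λ k → m*n≢0 ((3 + 3 * k) * (2 + 3 * k) * (1 + 3 * k) * (2 + 4 * k)) _ {{_}}
      {{m*n≢0 _ _ {{(3 * k) !≢0}} {{k !* (2 * k) !≢0}}}})
    where
    lemma : ∀ k g f e → (3 + 3 * k) * (2 + 3 * k) * (1 + 3 * k) * g * ((1 + k) * f * ((2 + 2 * k) * (1 + 2 * k) * e))
      ≡ (3 + 3 * k) * (2 + 3 * k) * (1 + 3 * k) * (2 + 4 * k) * ((1 + k) * (1 + k)) * (g * (f * e))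
    lemma = solve-∀
    lemma₂ : ∀ k f → (6 + 6 * k) * ((5 + 6 * k) * ((4 + 6 * k) * ((3 + 6 * k) * ((2 + 6 * k) * ((1 + 6 * k) * f)))))
      ≡ (3 + 3 * k) * (2 + 3 * k) * (1 + 3 * k) * (2 + 4 * k) * (12 * (36 * (k * (1 + k)) + 5)) * f
    lemma₂ = solve-∀

open import Data.Bool using (true; false; T)
open import Data.Bool.ListAction using (any)
open import Data.Empty using (⊥)
open import Data.Integer as ℤ using (ℤ; +_; -_; _+_; _*_; _-_; _^_; 0ℤ; 1ℤ; -1ℤ; _%ℕ_; _/ℕ_)
open import Data.Integer.Divisibility.Signed
  using (_∣_; divides; ∣n⇒∣m*n; ∣m⇒∣m*n; ∣m∣n⇒∣m+n; ∣m⇒∣-m; ∣-refl; ∣-trans; ∣⇒∣ᵤ; ∣ᵤ⇒∣; *-cancelʳ-∣)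
open import Data.Integer.DivMod using (a≡a%ℕn+[a/ℕn]*n; n%ℕd<d)
open import Data.Integer.Properties
  using (+-identityˡ; +-identityʳ; +-comm; *-zeroʳ; *-identityʳ; *-assoc; *-comm; abs-*; pos-*; ^-distribˡ-+-*)
open import Data.Integer.Tactic.RingSolver using (solve-∀)
open import Data.List using (List; []; _∷_; length; upTo)
open import Data.List.Membership.Propositional using (find; lose)
open import Data.List.Membership.Propositional.Properties using (∈-upTo⁺)
open import Data.List.Relation.Unary.All using (All; []; _∷_)
open import Data.List.Relation.Unary.Any.Properties using (any⁺; any⁻)
open import Data.Nat as ℕ using (ℕ; zero; suc; z≤n; s≤s; _>_)
import Data.Nat.Divisibility as ℕ
import Data.Nat.DivMod as ℕ
open import Data.Nat.Primality using (Prime; euclidsLemma; prime⇒nonZero; prime⇒irreducible; ¬prime[1])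
import Data.Nat.Properties as ℕ
import Data.Nat.Tactic.RingSolver as ℕ-Solver
open import Data.Product using (∃; _,_; _×_; proj₁; proj₂)
open import Data.Rational as ℚ using (ℚ; _/_; 0ℚ; 1ℚ; fromℚᵘ)
import Data.Rational.Properties as ℚ
open import Data.Rational.Unnormalised as ℚᵘ using (mkℚᵘ; *≡*)
import Data.Rational.Unnormalised.Properties as ℚᵘ
open import Data.Sum using (_⊎_; inj₁; inj₂)
open import Data.Unit using (tt)
open import Relation.Binary.Definitions using (tri<; tri≈; tri>)
open import Relation.Binary.PropositionalEquality
open import Relation.Nullary using (¬_; contradiction)

open Numerators using (A₁; A₂; A₃; A₁-recurrence; A₂-recurrence; A₃-recurrence)

-- Certificates for the ring solver: a goal follows from hypotheses once it is written as a linear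
-- combination of them with explicit polynomial multipliers, and that identity holds in every
-- commutative ring.
combine₁ : ∀ {l r x y} c → l ≡ r → x ≡ y + c * (l - r) → x ≡ y
combine₁ {l} {y = y} c refl eq = trans eq (lemma y c l)
  where
  lemma : ∀ y c l → y + c * (l - l) ≡ y
  lemma = solve-∀

combine₂ : ∀ {l r l′ r′ x y} c c′ → l ≡ r → l′ ≡ r′ →
           x ≡ y + c * (l - r) + c′ * (l′ - r′) → x ≡ y
combine₂ c c′ e e′ eq = combine₁ c e (combine₁ c′ e′ eq)

∣-combine₁ : ∀ {n a x} c → n ∣ a → x ≡ c * a → n ∣ x
∣-combine₁ c n∣a refl = ∣n⇒∣m*n c n∣a

∣-combine₂ : ∀ {n a b x} c c′ → n ∣ a → n ∣ b → x ≡ c * a + c′ * b → n ∣ x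
∣-combine₂ c c′ n∣a n∣b refl = ∣m∣n⇒∣m+n (∣n⇒∣m*n c n∣a) (∣n⇒∣m*n c′ n∣b)

-- Finite sums

∑ : (ℕ → ℤ) → ℕ → ℤ
∑ f zero    = 0ℤ
∑ f (suc n) = ∑ f n + f n

∑-cong : ∀ {f g} n → (∀ k → k ℕ.< n → f k ≡ g k) → ∑ f n ≡ ∑ g n
∑-cong zero    f≡g = refl
∑-cong (suc n) f≡g = cong₂ _+_ (∑-cong n λ k k<n → f≡g k (ℕ.m<n⇒m<1+n k<n)) (f≡g n ℕ.≤-refl)

∑-distrib-+ : ∀ (f g : ℕ → ℤ) n → ∑ (λ k → f k + g k) n ≡ ∑ f n + ∑ g n
∑-distrib-+ f g zero    = refl
∑-distrib-+ f g (suc n) =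
  trans (cong (_+ (f n + g n)) (∑-distrib-+ f g n)) (lemma (∑ f n) (∑ g n) (f n) (g n))
  where
  lemma : ∀ a b c d → a + b + (c + d) ≡ a + c + (b + d)
  lemma = solve-∀

*-distribˡ-∑ : ∀ c (f : ℕ → ℤ) n → c * ∑ f n ≡ ∑ (λ k → c * f k) n
*-distribˡ-∑ c f zero    = *-zeroʳ c
*-distribˡ-∑ c f (suc n) = trans (lemma c (∑ f n) (f n)) (cong (_+ c * f n) (*-distribˡ-∑ c f n))
  where
  lemma : ∀ c a b → c * (a + b) ≡ c * a + c * b
  lemma = solve-∀

∑-zero : ∀ n → ∑ (λ _ → 0ℤ) n ≡ 0ℤ
∑-zero zero    = refl
∑-zero (suc n) = trans (+-identityʳ _) (∑-zero n)

∑-swap : ∀ (f : ℕ → ℕ → ℤ) m n → ∑ (λ i → ∑ (λ k → f k i) n) m ≡ ∑ (λ k → ∑ (f k) m) n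
∑-swap f zero    n = sym (∑-zero n)
∑-swap f (suc m) n =
  trans (cong (_+ ∑ (λ k → f k m) n) (∑-swap f m n))
        (sym (∑-distrib-+ (λ k → ∑ (f k) m) (λ k → f k m) n))

∑-telescope : ∀ (U : ℕ → ℤ) n → ∑ (λ k → U k - U (suc k)) n ≡ U 0 - U n
∑-telescope U zero    = lemma (U 0)
  where
  lemma : ∀ a → 0ℤ ≡ a - a
  lemma = solve-∀
∑-telescope U (suc n) =
  trans (cong (_+ (U n - U (suc n))) (∑-telescope U n)) (lemma (U 0) (U n) (U (suc n)))
  where
  lemma : ∀ a b c → a - b + (b - c) ≡ a - c
  lemma = solve-∀

∑-suc : ∀ (f : ℕ → ℤ) n → ∑ f (suc n) ≡ f 0 + ∑ (λ k → f (suc k)) n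
∑-suc f zero    = +-comm 0ℤ (f 0)
∑-suc f (suc n) =
  trans (cong (_+ f (suc n)) (∑-suc f n)) (lemma (f 0) (∑ (λ k → f (suc k)) n) (f (suc n)))
  where
  lemma : ∀ a b c → a + b + c ≡ a + (b + c)
  lemma = solve-∀

∣∑ : ∀ {d f} n → (∀ k → k ℕ.< n → d ∣ f k) → d ∣ ∑ f n
∣∑ zero    d∣f = divides 0ℤ refl
∣∑ (suc n) d∣f = ∣m∣n⇒∣m+n (∣∑ n λ k k<n → d∣f k (ℕ.m<n⇒m<1+n k<n)) (d∣f n ℕ.≤-refl)

-- The Kronecker delta as the coefficient of xⁱ in xᵏ: the recursion is multiplication by x, as that
-- of `E` is multiplication by 1 - x.
δ : ℕ → ℕ → ℤ
δ zero    zero    = 1ℤ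
δ zero    (suc i) = 0ℤ
δ (suc k) zero    = 0ℤ
δ (suc k) (suc i) = δ k i

δ-diag : ∀ k → δ k k ≡ 1ℤ
δ-diag zero    = refl
δ-diag (suc k) = δ-diag k

δ-< : ∀ {k i} → k ℕ.< i → δ k i ≡ 0ℤ
δ-< {zero}  (s≤s _)   = refl
δ-< {suc k} (s≤s k<i) = δ-< k<i

∑-δ : ∀ (f : ℕ → ℤ) {i} n → i ℕ.< n → ∑ (λ k → f k * δ k i) n ≡ f i
∑-δ f {zero}  (suc n) _ =
  trans (∑-suc _ n)
  (trans (cong₂ _+_ (*-1 (f 0)) (trans (∑-cong n λ k _ → *-zeroʳ (f (suc k))) (∑-zero n)))
         (+-identityʳ (f 0)))
  where
  *-1 : ∀ x → x * 1ℤ ≡ x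
  *-1 = solve-∀
∑-δ f {suc i} (suc n) (s≤s i<n) =
  trans (∑-suc _ n) (trans (cong₂ _+_ (*-zeroʳ (f 0)) (∑-δ (λ k → f (suc k)) n i<n)) (+-identityˡ _))

-- Signed binomial coefficients

-- E k i = (-1)ⁱ C(k,i) is the coefficient of xⁱ in (1 - x)ᵏ.
E : ℕ → ℕ → ℤ
E zero    zero    = 1ℤ
E zero    (suc i) = 0ℤ
E (suc k) zero    = E k zero
E (suc k) (suc i) = E k (suc i) - E k i

E-zero : ∀ k → E k 0 ≡ 1ℤ
E-zero zero    = refl
E-zero (suc k) = E-zero k

E-< : ∀ {k i} → k ℕ.< i → E k i ≡ 0ℤ
E-< {zero}  (s≤s _)   = refl
E-< {suc k} (s≤s k<i) = cong₂ _-_ (E-< (ℕ.m<n⇒m<1+n k<i)) (E-< k<i)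

E-diag : ∀ k → E k k ≡ -1ℤ ^ k
E-diag zero    = refl
E-diag (suc k) = trans (cong₂ _-_ (E-< (ℕ.n<1+n k)) (E-diag k)) (lemma (-1ℤ ^ k))
  where
  lemma : ∀ x → 0ℤ - x ≡ -1ℤ * x
  lemma = solve-∀

-- Pascal's rule reduces k + 1 to two instances for k. This is (i+1) C(k,i+1) = (k-i) C(k,i) with
-- signs, and it also covers i ≥ k, where both sides vanish.
E-ratio : ∀ k i → (1ℤ + + i) * E k (suc i) ≡ (+ i - + k) * E k i
E-ratio zero    zero    = refl
E-ratio zero    (suc i) = trans (*-zeroʳ (1ℤ + + suc i)) (sym (*-zeroʳ (+ suc i - 0ℤ)))
E-ratio (suc k) zero    = combine₁ 1ℤ (E-ratio k 0) (lemma (+ k) (E k 1) (E k 0))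
  where
  lemma : ∀ k e₁ e₀ → (1ℤ + 0ℤ) * (e₁ - e₀)
    ≡ (0ℤ - (1ℤ + k)) * e₀ + 1ℤ * ((1ℤ + 0ℤ) * e₁ - (0ℤ - k) * e₀)
  lemma = solve-∀
E-ratio (suc k) (suc i) =
  combine₂ 1ℤ -1ℤ (E-ratio k (suc i)) (E-ratio k i)
    (lemma (+ k) (+ i) (E k (2 ℕ.+ i)) (E k (suc i)) (E k i))
  where
  lemma : ∀ k i e₂ e₁ e₀ → (1ℤ + (1ℤ + i)) * (e₂ - e₁)
    ≡ (1ℤ + i - (1ℤ + k)) * (e₁ - e₀)
      + 1ℤ * ((1ℤ + (1ℤ + i)) * e₂ - (1ℤ + i - k) * e₁)
      + -1ℤ * ((1ℤ + i) * e₁ - (i - k) * e₀)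
  lemma = solve-∀

-- Coefficientwise form of the derivative of (1 - x)^(k+1), which is -(k+1)(1 - x)^k.
E-absorb : ∀ k i → (1ℤ + + i) * E (suc k) (suc i) ≡ - (1ℤ + + k) * E k i
E-absorb k i = combine₁ 1ℤ (E-ratio k i) (lemma (+ k) (+ i) (E k (suc i)) (E k i))
  where
  lemma : ∀ k i e₁ e₀ → (1ℤ + i) * (e₁ - e₀)
    ≡ - (1ℤ + k) * e₀ + 1ℤ * ((1ℤ + i) * e₁ - (i - k) * e₀)
  lemma = solve-∀

-- Partial summation of coefficients is division by 1 - x.
∑-E-suc : ∀ k n → ∑ (E (suc k)) (suc n) ≡ E k n
∑-E-suc k zero    = +-identityˡ (E k 0)
∑-E-suc k (suc n) = trans (cong (_+ E (suc k) (suc n)) (∑-E-suc k n)) (lemma (E k n) (E k (suc n)))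
  where
  lemma : ∀ a b → a + (b - a) ≡ b
  lemma = solve-∀

-- The value of (1 - x)ᵏ at x = 1.
∑-E : ∀ k n → k ℕ.< n → ∑ (E k) n ≡ δ k 0
∑-E zero    (suc n) _         = trans (∑-suc (E 0) n) (cong (λ s → 1ℤ + s) (∑-zero n))
∑-E (suc k) (suc n) (s≤s k<n) = trans (∑-E-suc k n) (E-< k<n)

-- Reflection modulo p²

-1^-square : ∀ n → -1ℤ ^ n * -1ℤ ^ n ≡ 1ℤ
-1^-square zero    = refl
-1^-square (suc n) = trans (lemma (-1ℤ ^ n)) (-1^-square n)
  where
  lemma : ∀ x → -1ℤ * x * (-1ℤ * x) ≡ x * x
  lemma = solve-∀

-- Cancellation of units modulo a prime and its square.

module PrimeDivisibility {p : ℕ} (p-prime : Prime p) where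

  private instance _ = prime⇒nonZero p-prime

  P : ℤ
  P = + p

  euclid : ∀ x y → P ∣ x * y → P ∣ x ⊎ P ∣ y
  euclid x y P∣xy with euclidsLemma ℤ.∣ x ∣ ℤ.∣ y ∣ p-prime (subst (p ℕ.∣_) (abs-* x y) (∣⇒∣ᵤ P∣xy))
  ... | inj₁ p∣x = inj₁ (∣ᵤ⇒∣ p∣x)
  ... | inj₂ p∣y = inj₂ (∣ᵤ⇒∣ p∣y)

  P-cancel : ∀ x {y} → ¬ P ∣ x → P ∣ x * y → P ∣ y
  P-cancel x {y} P∤x P∣xy with euclid x y P∣xy
  ... | inj₁ P∣x = contradiction P∣x P∤x
  ... | inj₂ P∣y = P∣y

  P∤* : ∀ {x y} → ¬ P ∣ x → ¬ P ∣ y → ¬ P ∣ x * y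
  P∤* P∤x P∤y P∣xy = P∤y (P-cancel _ P∤x P∣xy)

  P²∣⇒P∣ : ∀ {x} → P * P ∣ x → P ∣ x
  P²∣⇒P∣ = ∣-trans (divides P refl)

  -- Euclid's lemma used twice: first y = zP, then, after one P is divided out, P divides z.
  P²-cancel : ∀ x {y} → ¬ P ∣ x → P * P ∣ x * y → P * P ∣ y
  P²-cancel x {y} P∤x P²∣xy with P-cancel x P∤x (P²∣⇒P∣ P²∣xy)
  ... | divides z refl =
    subst (P * P ∣_) (*-comm P z)
      (lift (P-cancel x P∤x (*-cancelʳ-∣ P (subst (P * P ∣_) (sym (*-assoc x z P)) P²∣xy))))
    where
    lift : P ∣ z → P * P ∣ P * z
    lift (divides w refl) = divides w (lemma P w)
      where
      lemma : ∀ P w → P * (w * P) ≡ w * (P * P)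
      lemma = solve-∀

  P∤small : ∀ n → suc n ℕ.< p → ¬ P ∣ + suc n
  P∤small n n<p P∣n = ℕ.>⇒∤ n<p (∣⇒∣ᵤ P∣n)

-- Symmetry of a truncated hypergeometric polynomial under x ↦ 1 - x.

module Reflection
  {p : ℕ} (p-prime : Prime p) (2<p : 2 ℕ.< p) (K L : ℤ) (B : ℕ → ℤ)
  (rec : ∀ k → k ℕ.< p → K * ((1ℤ + + k) * (1ℤ + + k)) * B (suc k)
     ≡ (K * (+ k * (1ℤ + + k)) + L) * B k)
  (K-unit : ¬ + p ∣ K) (B₀-unit : ¬ + p ∣ B 0)
  (q : ℕ) (q<p : q ℕ.< p)
  (root : + p ∣ K * (+ q * (1ℤ + + q)) + L)
  (nonroot : ∀ k → k ℕ.< q → ¬ + p ∣ K * (+ k * (1ℤ + + k)) + L)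
  where

  open PrimeDivisibility p-prime

  R : ℕ → ℤ
  R k = K * (+ k * (1ℤ + + k)) + L

  -- The coefficient of xⁱ in f(1 - x), where f(x) = Σ B k xᵏ.
  G : ℕ → ℤ
  G i = ∑ (λ k → B k * E k i) p

  leading : ℕ → ℤ
  leading k = K * ((1ℤ + + k) * (1ℤ + + k))

  leading-unit : ∀ k → suc k ℕ.< p → ¬ P ∣ leading k
  leading-unit k k<p = P∤* K-unit (P∤* (P∤small k k<p) (P∤small k k<p))

  -- A creative-telescoping certificate: the recurrence operator in i, applied to the summand B k *
  -- E k i of `G`, becomes a difference in k.
  U : ℕ → ℕ → ℤ
  U i k = - (K * + k * (1ℤ + + i) * B k * E k (suc i))

  U-step : ∀ i k → k ℕ.< p →
           leading i * (B k * E k (suc i)) + - R i * (B k * E k i) ≡ U i k - U i (suc k)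
  U-step i k k<p =
    -- The three hypotheses turn every term into a multiple of B k * E k i; what is left is
    -- (i+k+1)(i-k) = i(i+1) - k(k+1).
    combine₁ (E k i) (rec k k<p)
      (combine₂ (K * B k * (1ℤ + + i + + k)) (- (K * (1ℤ + + k) * B (suc k)))
        (E-ratio k i) (E-absorb k i)
        (lemma K L (+ i) (+ k) (B k) (B (suc k)) (E k i) (E k (suc i)) (E (suc k) (suc i))))
    where
    lemma : ∀ K L i k b b′ e₀ e₁ e′ →
      K * ((1ℤ + i) * (1ℤ + i)) * (b * e₁) + - (K * (i * (1ℤ + i)) + L) * (b * e₀)
      ≡ - (K * k * (1ℤ + i) * b * e₁) - - (K * (1ℤ + k) * (1ℤ + i) * b′ * e′)
        + e₀ * (K * ((1ℤ + k) * (1ℤ + k)) * b′ - (K * (k * (1ℤ + k)) + L) * b)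
        + K * b * (1ℤ + i + k) * ((1ℤ + i) * e₁ - (i - k) * e₀)
        + - (K * (1ℤ + k) * b′) * ((1ℤ + i) * e′ - - (1ℤ + k) * e₀)
    lemma = solve-∀

  -- `U` vanishes at k = 0. At k = p one factor p is explicit and the second comes from (1+i) E p
  -- (i+1) = -p E (p-1) i; the argument n exposes p as a successor.
  U-end : ∀ i n → P ≡ + n → P * P ∣ U i 0 - U i n
  U-end i zero    _    = divides 0ℤ (lemma K (+ i) (B 0) (E 0 (suc i)))
    where
    lemma : ∀ K i b e → - (K * 0ℤ * (1ℤ + i) * b * e) - - (K * 0ℤ * (1ℤ + i) * b * e) ≡ 0ℤ
    lemma = solve-∀
  U-end i (suc n) refl = divides (- (K * B p * E n i))
    (combine₁ (K * P * B p) (E-absorb n i)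
      (lemma K (+ i) (+ n) (B 0) (B p) (E 0 (suc i)) (E n i) (E p (suc i))))
    where
    lemma : ∀ K i n b₀ b e₀ e e′ →
      - (K * 0ℤ * (1ℤ + i) * b₀ * e₀) - - (K * (1ℤ + n) * (1ℤ + i) * b * e′)
      ≡ - (K * b * e) * ((1ℤ + n) * (1ℤ + n))
        + K * (1ℤ + n) * b * ((1ℤ + i) * e′ - - (1ℤ + n) * e)
    lemma = solve-∀

  -- The differential equation satisfied by f(x) = Σ B k xᵏ is invariant under x ↦ 1 - x, up to a
  -- boundary term divisible by p².
  G-rec : ∀ i → P * P ∣ leading i * G (suc i) + - R i * G i
  G-rec i = subst (P * P ∣_) (sym equation) (U-end i p refl)
    where
    open ≡-Reasoning
    equation : leading i * G (suc i) + - R i * G i ≡ U i 0 - U i p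
    equation = begin
      leading i * G (suc i) + - R i * G i
        ≡⟨ cong₂ _+_ (*-distribˡ-∑ (leading i) _ p) (*-distribˡ-∑ (- R i) _ p) ⟩
      ∑ (λ k → leading i * (B k * E k (suc i))) p + ∑ (λ k → - R i * (B k * E k i)) p
        ≡⟨ ∑-distrib-+ _ _ p ⟨
      ∑ (λ k → leading i * (B k * E k (suc i)) + - R i * (B k * E k i)) p
        ≡⟨ ∑-cong p (U-step i) ⟩
      ∑ (λ k → U i k - U i (suc k)) p
        ≡⟨ ∑-telescope (U i) p ⟩
      U i 0 - U i p ∎

  -- Modulo p² both `G` and `B` satisfy the same first-order recurrence, whose leading coefficient
  -- is a unit as long as i + 1 < p. Cross-multiplication avoids inverses.
  G-proportional : ∀ i → i ℕ.< p → P * P ∣ B 0 * G i + - G 0 * B i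
  G-proportional zero    _   = divides 0ℤ (lemma (B 0) (G 0))
    where
    lemma : ∀ b g → b * g + - g * b ≡ 0ℤ
    lemma = solve-∀
  G-proportional (suc i) i<p =
    P²-cancel (leading i) (leading-unit i i<p)
      (∣-combine₂ (B 0) (R i) (G-rec i) (G-proportional i (ℕ.<⇒≤ i<p))
        (combine₁ (- G 0) (rec i (ℕ.<⇒≤ i<p))
          (lemma (leading i) (R i) (B 0) (B i) (B (suc i)) (G 0) (G i) (G (suc i)))))
    where
    lemma : ∀ l r b₀ b b′ g₀ g g′ → l * (b₀ * g′ + - g₀ * b′)
      ≡ b₀ * (l * g′ + - r * g) + r * (b₀ * g + - g₀ * b) + - g₀ * (l * b′ - r * b)
    lemma = solve-∀

  -- Both sides are the value of f(1 - x) at x = 1.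
  ∑G≡B₀ : ∑ G p ≡ B 0
  ∑G≡B₀ = begin
    ∑ G p                          ≡⟨ ∑-swap (λ k i → B k * E k i) p p ⟩
    ∑ (λ k → ∑ (λ i → B k * E k i) p) p ≡⟨ ∑-cong p (λ k k<p → sym (*-distribˡ-∑ (B k) (E k) p)) ⟩
    ∑ (λ k → B k * ∑ (E k) p) p    ≡⟨ ∑-cong p (λ k k<p → cong (B k *_) (∑-E k p k<p)) ⟩
    ∑ (λ k → B k * δ k 0) p        ≡⟨ ∑-δ B p (ℕ.≤-<-trans z≤n q<p) ⟩
    B 0                            ∎
    where open ≡-Reasoning

  -- Both sides are f(1), on the right as the constant term of f(1 - x).
  ∑B≡G₀ : ∑ B p ≡ G 0
  ∑B≡G₀ = ∑-cong p λ k _ → sym (trans (cong (B k *_) (E-zero k)) (*-identityʳ (B k)))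

  -- Evaluate the proportionality of f(1 - x) and f(x) at x = 1.
  B₀²≡G₀² : P * P ∣ B 0 * B 0 + - G 0 * G 0
  B₀²≡G₀² = subst (P * P ∣_) equation (∣∑ p G-proportional)
    where
    open ≡-Reasoning
    equation : ∑ (λ i → B 0 * G i + - G 0 * B i) p ≡ B 0 * B 0 + - G 0 * G 0
    equation = begin
      ∑ (λ i → B 0 * G i + - G 0 * B i) p ≡⟨ ∑-distrib-+ _ _ p ⟩
      ∑ (λ i → B 0 * G i) p + ∑ (λ i → - G 0 * B i) p
        ≡⟨ cong₂ _+_ (*-distribˡ-∑ (B 0) G p) (*-distribˡ-∑ (- G 0) B p) ⟨
      B 0 * ∑ G p + - G 0 * ∑ B p
        ≡⟨ cong₂ (λ s t → B 0 * s + - G 0 * t) ∑G≡B₀ ∑B≡G₀ ⟩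
      B 0 * B 0 + - G 0 * G 0 ∎

  -- R q ≡ 0 kills B (q+1) modulo p, and the recurrence propagates the zero: modulo p, f has degree
  -- at most q.
  B-beyond : ∀ k → q ℕ.< k → k ℕ.< p → P ∣ B k
  B-beyond (suc k) (s≤s q≤k) k<p =
    P-cancel (leading k) (leading-unit k k<p)
      (subst (P ∣_) (sym (rec k (ℕ.<⇒≤ k<p))) (step (ℕ.m≤n⇒m<n∨m≡n q≤k)))
    where
    step : q ℕ.< k ⊎ q ≡ k → P ∣ R k * B k
    step (inj₁ q<k)  = ∣n⇒∣m*n (R k) (B-beyond k q<k (ℕ.<⇒≤ k<p))
    step (inj₂ refl) = ∣m⇒∣m*n (B k) root

  -- The recurrence read backwards: R k is a unit for k < q, so p dividing B (k+1) would force p to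
  -- divide B k.
  B-unit : ∀ k → k ℕ.≤ q → ¬ P ∣ B k
  B-unit zero    _   = B₀-unit
  B-unit (suc k) k<q P∣B =
    P∤* (nonroot k k<q) (B-unit k (ℕ.<⇒≤ k<q))
      (subst (P ∣_) (rec k (ℕ.<-trans k<q q<p)) (∣n⇒∣m*n (leading k) P∣B))

  σ : ℤ
  σ = -1ℤ ^ q

  -- Comparison of the coefficients of x^q: terms with k < q have E k q = 0, those with k > q vanish
  -- modulo p, and E q q = σ. Writing B q as a sum against `δ` makes the comparison termwise.
  G-at-root : P ∣ G q + - σ * B q
  G-at-root = subst (P ∣_) equation (∣∑ p terms)
    where
    terms : ∀ k → k ℕ.< p → P ∣ B k * E k q + - σ * (B k * δ k q)
    terms k k<p with ℕ.<-cmp k q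
    ... | tri< k<q _ _ rewrite E-< k<q | δ-< k<q = divides 0ℤ (lemma (B k) (- σ))
      where
      lemma : ∀ b s → b * 0ℤ + s * (b * 0ℤ) ≡ 0ℤ
      lemma = solve-∀
    ... | tri≈ _ refl _ rewrite E-diag k | δ-diag k = divides 0ℤ (lemma (B k) (-1ℤ ^ k))
      where
      lemma : ∀ b s → b * s + - s * (b * 1ℤ) ≡ 0ℤ
      lemma = solve-∀
    ... | tri> _ _ q<k =
      ∣-combine₁ (E k q + - σ * δ k q) (B-beyond k q<k k<p) (lemma (B k) (E k q) (- σ) (δ k q))
      where
      lemma : ∀ b e s d → b * e + s * (b * d) ≡ (e + s * d) * b
      lemma = solve-∀
    equation : ∑ (λ k → B k * E k q + - σ * (B k * δ k q)) p ≡ G q + - σ * B q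
    equation = trans (∑-distrib-+ _ _ p)
      (cong (λ s → G q + s) (trans (sym (*-distribˡ-∑ (- σ) _ p)) (cong (- σ *_) (∑-δ B p q<p))))

  G₀≡σB₀-mod-P : P ∣ σ * B 0 + - G 0
  G₀≡σB₀-mod-P =
    P-cancel (B q) (B-unit q ℕ.≤-refl)
      (∣-combine₂ 1ℤ (- B 0) (P²∣⇒P∣ (G-proportional q q<p)) G-at-root
        (lemma (B q) (B 0) (G 0) (G q) σ))
    where
    lemma : ∀ b b₀ g₀ g s →
      b * (s * b₀ + - g₀) ≡ 1ℤ * (b₀ * g + - g₀ * b) + - b₀ * (g + - s * b)
    lemma = solve-∀

  -- Lifts the sign from p to p²: (σB₀ + G₀)(σB₀ - G₀) = B₀² - G₀² vanishes modulo p², and modulo p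
  -- the first factor is 2σB₀, a unit since p > 2.
  G₀≡σB₀ : P * P ∣ σ * B 0 + - G 0
  G₀≡σB₀ = P²-cancel (σ * B 0 + G 0) other-factor
    (subst (P * P ∣_) (sym (combine₁ (B 0 * B 0) (-1^-square q) (lemma σ (B 0) (G 0)))) B₀²≡G₀²)
    where
    lemma : ∀ s b g → (s * b + g) * (s * b + - g) ≡ b * b + - g * g + b * b * (s * s - 1ℤ)
    lemma = solve-∀
    lemma₂ : ∀ s b g → (+ 2) * b ≡ s * (s * b + g) + s * (s * b + - g) + - (+ 2 * b) * (s * s - 1ℤ)
    lemma₂ = solve-∀
    other-factor : ¬ P ∣ σ * B 0 + G 0
    other-factor P∣ = P∤* (P∤small 1 2<p) B₀-unit
      (∣-combine₂ σ σ P∣ G₀≡σB₀-mod-P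
        (combine₁ (- (+ 2 * B 0)) (-1^-square q) (lemma₂ σ (B 0) (G 0))))

  G≡σB : ∀ i → i ℕ.< p → P * P ∣ G i + - σ * B i
  G≡σB i i<p = P²-cancel (B 0) B₀-unit
    (∣-combine₂ 1ℤ (- B i) (G-proportional i i<p) G₀≡σB₀ (lemma (B 0) (B i) (G 0) (G i) σ))
    where
    lemma : ∀ b₀ b g₀ g s →
      b₀ * (g + - s * b) ≡ 1ℤ * (b₀ * g + - g₀ * b) + - b * (s * b₀ + - g₀)
    lemma = solve-∀

-- Euler's criterion

eval : List ℤ → ℤ → ℤ
eval []       x = 0ℤ
eval (c ∷ cs) x = c + x * eval cs x

-- The coefficients of (f(x) - f(r)) / (x - r) for f with coefficients c ∷ cs; they do not depend
-- on the constant term c.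
quotient : List ℤ → ℤ → List ℤ
quotient []       r = []
quotient (c ∷ cs) r = eval (c ∷ cs) r ∷ quotient cs r

length-quotient : ∀ cs r → length (quotient cs r) ≡ length cs
length-quotient []       r = refl
length-quotient (c ∷ cs) r = cong suc (length-quotient cs r)

eval-quotient : ∀ c cs r x →
  eval (c ∷ cs) x ≡ eval (c ∷ cs) r + (x - r) * eval (quotient cs r) x
eval-quotient c []       r x = lemma c x r
  where
  lemma : ∀ c x r → c + x * 0ℤ ≡ c + r * 0ℤ + (x - r) * 0ℤ
  lemma = solve-∀
eval-quotient c (d ∷ cs) r x =
  combine₁ x (eval-quotient d cs r x)
    (lemma c x r (eval (d ∷ cs) x) (eval (d ∷ cs) r) (eval (quotient cs r) x))
  where
  lemma : ∀ c x r f g h → c + x * f ≡ c + r * g + (x - r) * (g + x * h) + x * (f - (g + (x - r) * h))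
  lemma = solve-∀

monomial : ℕ → List ℤ
monomial zero    = 1ℤ ∷ []
monomial (suc n) = 0ℤ ∷ monomial n

length-monomial : ∀ n → length (monomial n) ≡ suc n
length-monomial zero    = refl
length-monomial (suc n) = cong suc (length-monomial n)

eval-monomial : ∀ n x → eval (monomial n) x ≡ x ^ n
eval-monomial zero    x = cong (λ s → 1ℤ + s) (*-zeroʳ x)
eval-monomial (suc n) x = trans (lemma x (eval (monomial n) x)) (cong (x *_) (eval-monomial n x))
  where
  lemma : ∀ x y → 0ℤ + x * y ≡ x * y
  lemma = solve-∀

^-double : ∀ x n → x ^ (n ℕ.+ n) ≡ (x * x) ^ n
^-double x zero    = refl
^-double x (suc n) = trans (cong (λ k → x * x ^ k) (ℕ.+-suc n n))
  (trans (lemma x (x ^ (n ℕ.+ n))) (cong (x * x *_) (^-double x n)))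
  where
  lemma : ∀ x y → x * (x * y) ≡ x * x * y
  lemma = solve-∀

neg-^-odd : ∀ x n → (- x) ^ suc (n ℕ.+ n) ≡ - (x ^ suc (n ℕ.+ n))
neg-^-odd x n = begin
  - x * (- x) ^ (n ℕ.+ n) ≡⟨ cong (- x *_) (^-double (- x) n) ⟩
  - x * (- x * - x) ^ n   ≡⟨ cong (λ y → - x * y ^ n) (square x) ⟩
  - x * (x * x) ^ n       ≡⟨ cong (- x *_) (^-double x n) ⟨
  - x * x ^ (n ℕ.+ n)     ≡⟨ pull x (x ^ (n ℕ.+ n)) ⟩
  - (x * x ^ (n ℕ.+ n))   ∎
  where
  open ≡-Reasoning
  square : ∀ x → - x * - x ≡ x * x
  square = solve-∀
  pull : ∀ x y → - x * y ≡ - (x * y)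
  pull = solve-∀

*-^ : ∀ x y n → (x * y) ^ n ≡ x ^ n * y ^ n
*-^ x y zero    = refl
*-^ x y (suc n) = trans (cong (x * y *_) (*-^ x y n)) (lemma x y (x ^ n) (y ^ n))
  where
  lemma : ∀ x y a b → x * y * (a * b) ≡ x * a * (y * b)
  lemma = solve-∀

-1^-cases : ∀ n → (-1ℤ ^ n ≡ 1ℤ) ⊎ (-1ℤ ^ n ≡ -1ℤ)
-1^-cases zero = inj₁ refl
-1^-cases (suc n) with -1^-cases n
... | inj₁ e = inj₂ (cong (-1ℤ *_) e)
... | inj₂ e = inj₁ (cong (-1ℤ *_) e)

-- The bound n is left free above k because the induction uses it both at n and at n + 1.
binomial : ∀ y k n → k ℕ.< n → (1ℤ - y) ^ k ≡ ∑ (λ i → E k i * y ^ i) n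
binomial y zero    (suc n) _         = sym (trans (∑-suc _ n) (cong (λ s → 1ℤ + s) (∑-zero n)))
binomial y (suc k) (suc n) (s≤s k<n) = sym (begin
  ∑ (λ i → E (suc k) i * y ^ i) (suc n)
    ≡⟨ ∑-suc _ n ⟩
  E k 0 * 1ℤ + ∑ (λ i → (E k (suc i) - E k i) * (y * y ^ i)) n
    ≡⟨ cong (λ s → E k 0 * 1ℤ + s) (trans (∑-cong n λ i _ → split (E k (suc i)) (E k i) y (y ^ i))
         (∑-distrib-+ _ _ n)) ⟩
  E k 0 * 1ℤ + (∑ (λ i → E k (suc i) * (y * y ^ i)) n + ∑ (λ i → - y * (E k i * y ^ i)) n)
    ≡⟨ cong (λ s → E k 0 * 1ℤ + (∑ (λ i → E k (suc i) * (y * y ^ i)) n + s)) (*-distribˡ-∑ (- y) _ n) ⟨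
  E k 0 * 1ℤ + (∑ (λ i → E k (suc i) * (y * y ^ i)) n + - y * ∑ (λ i → E k i * y ^ i) n)
    ≡⟨ assoc (E k 0 * 1ℤ) _ _ ⟩
  E k 0 * 1ℤ + ∑ (λ i → E k (suc i) * (y * y ^ i)) n + - y * ∑ (λ i → E k i * y ^ i) n
    ≡⟨ cong (_+ - y * ∑ (λ i → E k i * y ^ i) n) (∑-suc (λ i → E k i * y ^ i) n) ⟨
  ∑ (λ i → E k i * y ^ i) (suc n) + - y * ∑ (λ i → E k i * y ^ i) n
    ≡⟨ cong₂ (λ s t → s + - y * t) (binomial y k (suc n) (ℕ.m<n⇒m<1+n k<n)) (binomial y k n k<n) ⟨
  (1ℤ - y) ^ k + - y * (1ℤ - y) ^ k
    ≡⟨ collect y ((1ℤ - y) ^ k) ⟩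
  (1ℤ - y) * (1ℤ - y) ^ k ∎)
  where
  open ≡-Reasoning
  split : ∀ e₁ e₀ y z → (e₁ - e₀) * (y * z) ≡ e₁ * (y * z) + - y * (e₀ * z)
  split = solve-∀
  assoc : ∀ a b c → a + (b + c) ≡ a + b + c
  assoc = solve-∀
  collect : ∀ y z → z + - y * z ≡ (1ℤ - y) * z
  collect = solve-∀

-- Factorials and double factorials.

factorial : ℕ → ℤ
factorial zero    = 1ℤ
factorial (suc n) = (1ℤ + + n) * factorial n

-- The double factorial (2n - 1)!! = 1 · 3 ⋯ (2n - 1).
oddFactorial : ℕ → ℤ
oddFactorial zero    = 1ℤ
oddFactorial (suc n) = (1ℤ + (+ n + + n)) * oddFactorial n

-- The even factors 2, 4, ..., 2n contribute 2ⁿ n!, the odd ones a double factorial; the two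
-- statements feed each other one factor at a time.
factorial-odd : ∀ n → factorial (suc (n ℕ.+ n)) ≡ (+ 2) ^ n * factorial n * oddFactorial (suc n)
factorial-even : ∀ n → factorial (n ℕ.+ n) ≡ (+ 2) ^ n * factorial n * oddFactorial n

factorial-odd n = trans (cong ((1ℤ + (+ n + + n)) *_) (factorial-even n))
  (lemma (1ℤ + (+ n + + n)) ((+ 2) ^ n) (factorial n) (oddFactorial n))
  where
  lemma : ∀ a b c d → a * (b * c * d) ≡ b * c * (a * d)
  lemma = solve-∀
factorial-even zero    = refl
factorial-even (suc n) = trans (cong factorial (cong suc (ℕ.+-suc n n)))
  (trans (cong ((1ℤ + (1ℤ + (+ n + + n))) *_) (factorial-odd n))
         (lemma (+ n) ((+ 2) ^ n) (factorial n) (oddFactorial (suc n))))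
  where
  lemma : ∀ n b c d → (1ℤ + (1ℤ + (n + n))) * (b * c * d) ≡ (+ 2) * b * ((1ℤ + n) * c) * d
  lemma = solve-∀

-- Theorems of Lagrange, Fermat, Euler and Gauss for an odd prime.

module OddPrime {p : ℕ} (p-prime : Prime p) (h : ℕ) (p≡2h+1 : p ≡ suc (h ℕ.+ h)) where

  open PrimeDivisibility p-prime

  P∤diff : ∀ u v → u ℕ.< v → v ℕ.< p → ¬ P ∣ + v - + u
  P∤diff u v u<v v<p with ℕ.m≤n⇒∃[o]m+o≡n u<v
  ... | o , refl = λ P∣ → P∤small o (ℕ.≤-<-trans (s≤s (ℕ.m≤n+m o u)) v<p)
    (subst (P ∣_) (lemma (+ u) (+ o)) P∣)
    where
    lemma : ∀ u o → 1ℤ + (u + o) - u ≡ 1ℤ + o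
    lemma = solve-∀

  residues-unique : ∀ u v → u ℕ.< p → v ℕ.< p → P ∣ + u - + v → u ≡ v
  residues-unique u v u<p v<p P∣ with ℕ.<-cmp u v
  ... | tri≈ _ u≡v _ = u≡v
  ... | tri< u<v _ _ = contradiction (∣-combine₁ -1ℤ P∣ (lemma (+ u) (+ v))) (P∤diff u v u<v v<p)
    where
    lemma : ∀ u v → v - u ≡ -1ℤ * (u - v)
    lemma = solve-∀
  ... | tri> _ _ v<u = contradiction P∣ (P∤diff v u v<u u<p)

  -- Divide out the root ρ 0; since the differences ρ (i+1) - ρ 0 are units, the other nodes are
  -- roots of the quotient. A list of length n has degree below n, so n incongruent roots annihilate
  -- every value.
  lagrange : ∀ n cs → length cs ≡ n → (ρ : ℕ → ℤ) →
    (∀ i j → i ℕ.< j → j ℕ.< n → ¬ P ∣ ρ j - ρ i) →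
    (∀ i → i ℕ.< n → P ∣ eval cs (ρ i)) → ∀ x → P ∣ eval cs x
  lagrange n       []       _    ρ distinct root x = divides 0ℤ refl
  lagrange (suc n) (c ∷ cs) refl ρ distinct root x =
    subst (P ∣_) (sym (eval-quotient c cs (ρ 0) x))
      (∣m∣n⇒∣m+n (root 0 (s≤s z≤n)) (∣n⇒∣m*n (x - ρ 0)
        (lagrange n (quotient cs (ρ 0)) (length-quotient cs (ρ 0)) (λ i → ρ (suc i))
          (λ i j i<j j<n → distinct (suc i) (suc j) (s≤s i<j) (s≤s j<n)) quotient-root x)))
    where
    lemma : ∀ a b c → b ≡ c + a → a ≡ 1ℤ * b + -1ℤ * c
    lemma a _ c refl = identity a c
      where
      identity : ∀ a c → a ≡ 1ℤ * (c + a) + -1ℤ * c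
      identity = solve-∀
    quotient-root : ∀ i → i ℕ.< n → P ∣ eval (quotient cs (ρ 0)) (ρ (suc i))
    quotient-root i i<n = P-cancel (ρ (suc i) - ρ 0) (distinct 0 (suc i) (s≤s z≤n) (s≤s i<n))
      (∣-combine₂ 1ℤ -1ℤ (root (suc i) (s≤s i<n)) (root 0 (s≤s z≤n))
        (lemma _ _ _ (eval-quotient c cs (ρ 0) (ρ (suc i)))))

  -- By absorption (i+1) E p (i+1) is a multiple of p, and i + 1 < p is a unit, so only the two
  -- outer terms survive; the last has sign (-1)ᵖ = -1 because p is odd.
  frobenius : ∀ y n → P ≡ + suc n → P ∣ (1ℤ - y) ^ p - (1ℤ - y ^ p)
  frobenius y n refl = subst (P ∣_) (sym equation) (∣∑ n middle)
    where
    middle : ∀ i → i ℕ.< n → P ∣ E p (suc i) * y ^ suc i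
    middle i i<n = ∣m⇒∣m*n (y ^ suc i) (P-cancel (1ℤ + + i) (P∤small i (s≤s i<n))
      (divides (- E n i) (trans (E-absorb n i) (comm P (E n i)))))
      where
      comm : ∀ a b → - a * b ≡ - b * a
      comm = solve-∀
    last : E p p ≡ -1ℤ
    last = trans (E-diag p) (trans (cong (-1ℤ ^_) p≡2h+1)
      (cong (-1ℤ *_) (trans (^-double -1ℤ h) (ones h))))
      where
      ones : ∀ k → (-1ℤ * -1ℤ) ^ k ≡ 1ℤ
      ones zero    = refl
      ones (suc k) = cong (1ℤ *_) (ones k)
    equation : (1ℤ - y) ^ p - (1ℤ - y ^ p) ≡ ∑ (λ i → E p (suc i) * y ^ suc i) n
    equation = begin
      (1ℤ - y) ^ p - (1ℤ - y ^ p)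
        ≡⟨ cong (_- (1ℤ - y ^ p)) (binomial y p (suc p) ℕ.≤-refl) ⟩
      ∑ (λ i → E p i * y ^ i) p + E p p * y ^ p - (1ℤ - y ^ p)
        ≡⟨ cong₂ (λ s t → s + t * y ^ p - (1ℤ - y ^ p)) (∑-suc _ n) last ⟩
      E p 0 * 1ℤ + ∑ (λ i → E p (suc i) * y ^ suc i) n + -1ℤ * y ^ p - (1ℤ - y ^ p)
        ≡⟨ cong (λ s → s * 1ℤ + ∑ (λ i → E p (suc i) * y ^ suc i) n + -1ℤ * y ^ p - (1ℤ - y ^ p)) (E-zero p) ⟩
      1ℤ * 1ℤ + ∑ (λ i → E p (suc i) * y ^ suc i) n + -1ℤ * y ^ p - (1ℤ - y ^ p)
        ≡⟨ lemma (∑ (λ i → E p (suc i) * y ^ suc i) n) (y ^ p) ⟩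
      ∑ (λ i → E p (suc i) * y ^ suc i) n ∎
      where
      open ≡-Reasoning
      lemma : ∀ s z → 1ℤ * 1ℤ + s + -1ℤ * z - (1ℤ - z) ≡ s
      lemma = solve-∀

  neg-^p : ∀ x → (- x) ^ p ≡ - (x ^ p)
  neg-^p x = subst (λ k → (- x) ^ k ≡ - (x ^ k)) (sym p≡2h+1) (neg-^-odd x h)

  -- Induction on n: `frobenius` at y = -n gives (1+n)ᵖ ≡ 1 + nᵖ.
  fermat : ∀ n → P ∣ (+ n) ^ p - + n
  fermat zero    = divides 0ℤ (cong (λ k → 0ℤ ^ k - 0ℤ) p≡2h+1)
  fermat (suc n) = ∣-combine₂ 1ℤ 1ℤ (frobenius (- + n) (h ℕ.+ h) (cong +_ p≡2h+1)) (fermat n)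
    (combine₁ -1ℤ (neg-^p (+ n))
      (trans (cong (λ z → z ^ p - (1ℤ + + n)) (sub-neg (+ n)))
             (lemma (+ n) ((1ℤ - - + n) ^ p) ((+ n) ^ p) ((- + n) ^ p))))
    where
    sub-neg : ∀ n → 1ℤ + n ≡ 1ℤ - - n
    sub-neg = solve-∀
    lemma : ∀ n u v w → u - (1ℤ + n)
      ≡ 1ℤ * (u - (1ℤ - w)) + 1ℤ * (v - n) + -1ℤ * (w - - v)
    lemma = solve-∀

  -- n^(p-1) is written as (n²)ʰ, which exhibits n² as a root of xʰ - 1.
  fermat-unit : ∀ n → ¬ P ∣ + n → P ∣ (+ n * + n) ^ h - 1ℤ
  fermat-unit n P∤n = P-cancel (+ n) P∤n (subst (P ∣_) equation (fermat n))
    where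
    lemma : ∀ n x → n * x - n ≡ n * (x - 1ℤ)
    lemma = solve-∀
    equation : (+ n) ^ p - + n ≡ + n * ((+ n * + n) ^ h - 1ℤ)
    equation = trans (cong (λ k → (+ n) ^ k - + n) p≡2h+1)
      (trans (cong (λ z → + n * z - + n) (^-double (+ n) h)) (lemma (+ n) ((+ n * + n) ^ h)))

  ^-congruent : ∀ x y n → P ∣ x - y → P ∣ x ^ n - y ^ n
  ^-congruent x y zero    _  = divides 0ℤ refl
  ^-congruent x y (suc n) P∣ = ∣-combine₂ (x ^ n) y P∣ (^-congruent x y n P∣) (lemma x y (x ^ n) (y ^ n))
    where
    lemma : ∀ x y a b → x * a - y * b ≡ a * (x - y) + y * (a - b)
    lemma = solve-∀

  square⇒^h≡1 : ∀ a n → ¬ P ∣ a → P ∣ + n * + n - a → P ∣ a ^ h - 1ℤ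
  square⇒^h≡1 a n P∤a P∣ = ∣-combine₂ 1ℤ -1ℤ (fermat-unit n P∤n) (^-congruent _ _ h P∣)
    (lemma (a ^ h) ((+ n * + n) ^ h))
    where
    lemma : ∀ a b → a - 1ℤ ≡ 1ℤ * (b - 1ℤ) + -1ℤ * (b - a)
    lemma = solve-∀
    lemma₂ : ∀ a n → a ≡ n * n + -1ℤ * (n * n - a)
    lemma₂ = solve-∀
    P∤n : ¬ P ∣ + n
    P∤n P∣n = P∤a (∣-combine₂ (+ n) -1ℤ P∣n P∣ (lemma₂ a (+ n)))

  0<h : 0 ℕ.< h
  0<h = positive h p≡2h+1
    where
    positive : ∀ h → p ≡ suc (h ℕ.+ h) → 0 ℕ.< h
    positive zero    p≡1 = contradiction (subst Prime p≡1 p-prime) ¬prime[1]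
    positive (suc h) _   = s≤s z≤n

  -- Otherwise xʰ - 1 has the h + 1 roots a, 1², …, h².
  ^h≡1⇒square : ∀ a → P ∣ a ^ h - 1ℤ → ¬ (∀ x → x ℕ.< p → ¬ P ∣ + x * + x - a)
  ^h≡1⇒square a P∣aʰ-1 nonsquare = go h refl 0<h
    where
    ρ : ℕ → ℤ
    ρ zero    = a
    ρ (suc j) = + suc j * + suc j
    h<p : h ℕ.< p
    h<p = subst (h ℕ.<_) (sym p≡2h+1) (s≤s (ℕ.m≤m+n h h))
    distinct : ∀ i j → i ℕ.< j → j ℕ.< suc h → ¬ P ∣ ρ j - ρ i
    distinct zero    (suc j) _ (s≤s j<h) = nonsquare (suc j) (ℕ.≤-<-trans j<h h<p)
    distinct (suc i) (suc j) (s≤s i<j) (s≤s j<h) P∣ =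
      P∤* (P∤diff i j i<j (ℕ.<-trans j<h h<p)) (P∤small (suc (i ℕ.+ j)) i+j<p)
        (subst (P ∣_) (lemma (+ i) (+ j)) P∣)
      where
      lemma : ∀ i j → (1ℤ + j) * (1ℤ + j) - (1ℤ + i) * (1ℤ + i) ≡ (j - i) * (1ℤ + (1ℤ + (i + j)))
      lemma = solve-∀
      i+j<p : suc (suc (i ℕ.+ j)) ℕ.< p
      i+j<p = subst (suc (suc (i ℕ.+ j)) ℕ.<_) (sym p≡2h+1)
        (s≤s (subst (ℕ._≤ h ℕ.+ h) (cong suc (ℕ.+-suc i j)) (ℕ.+-mono-≤ (ℕ.<-trans i<j j<h) j<h)))
    ρ-root : ∀ i → i ℕ.< suc h → P ∣ ρ i ^ h - 1ℤ
    ρ-root zero    _         = P∣aʰ-1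
    ρ-root (suc i) (s≤s i<h) = fermat-unit (suc i) (P∤small i (ℕ.≤-<-trans i<h h<p))
    go : ∀ k → h ≡ k → 0 ℕ.< k → ⊥
    -- The polynomial xʰ - 1 has h + 1 coefficients, so it would vanish modulo p everywhere, but its
    -- value at 0 is -1.
    go (suc k) refl _ = P∤1 (∣-combine₁ -1ℤ
        (lagrange (suc h) (-1ℤ ∷ monomial k) (cong suc (length-monomial k)) ρ distinct
          (λ i i<n → subst (P ∣_) (sym (poly-eval (ρ i))) (ρ-root i i<n)) 0ℤ)
        refl)
      where
      poly-eval : ∀ x → eval (-1ℤ ∷ monomial k) x ≡ x ^ suc k - 1ℤ
      poly-eval x = trans (cong (λ z → -1ℤ + x * z) (eval-monomial k x)) (lemma (x * x ^ k))
        where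
        lemma : ∀ z → -1ℤ + z ≡ z - 1ℤ
        lemma = solve-∀
      P∤1 : ¬ P ∣ 1ℤ
      P∤1 = P∤small 0 (ℕ.≤-<-trans (s≤s z≤n) h<p)

  P∤2 : ¬ P ∣ + 2
  P∤2 = P∤small 1 (subst (2 ℕ.<_) (sym p≡2h+1) (s≤s (ℕ.+-mono-≤ 0<h 0<h)))

  square-residue⇒∣ : ∀ a .{{_ : ℕ.NonZero p}} x → (x ℕ.* x) ℕ.% p ≡ a %ℕ p → P ∣ + x * + x - a
  square-residue⇒∣ a x eq = divides (+ (x ℕ.* x ℕ./ p) - a /ℕ p) (begin
    + x * + x - a
      ≡⟨ cong₂ _-_ (trans (sym (pos-* x x)) (a≡a%ℕn+[a/ℕn]*n (+ (x ℕ.* x)) p)) (a≡a%ℕn+[a/ℕn]*n a p) ⟩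
    + (x ℕ.* x ℕ.% p) + + (x ℕ.* x ℕ./ p) * P - (+ (a %ℕ p) + a /ℕ p * P)
      ≡⟨ cong (λ r → + r + + (x ℕ.* x ℕ./ p) * P - (+ (a %ℕ p) + a /ℕ p * P)) eq ⟩
    + (a %ℕ p) + + (x ℕ.* x ℕ./ p) * P - (+ (a %ℕ p) + a /ℕ p * P)
      ≡⟨ lemma (+ (a %ℕ p)) (+ (x ℕ.* x ℕ./ p)) (a /ℕ p) P ⟩
    (+ (x ℕ.* x ℕ./ p) - a /ℕ p) * P ∎)
    where
    open ≡-Reasoning
    lemma : ∀ r u v P → r + u * P - (r + v * P) ≡ (u - v) * P
    lemma = solve-∀

  ∣⇒square-residue : ∀ a .{{_ : ℕ.NonZero p}} x → P ∣ + x * + x - a → (x ℕ.* x) ℕ.% p ≡ a %ℕ p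
  ∣⇒square-residue a x P∣ = residues-unique _ _ (ℕ.m%n<n (x ℕ.* x) p) (n%ℕd<d a p)
    (∣-combine₂ 1ℤ (a /ℕ p - + (x ℕ.* x ℕ./ p)) P∣ ∣-refl
      (combine₂ -1ℤ 1ℤ (trans (sym (pos-* x x)) (a≡a%ℕn+[a/ℕn]*n (+ (x ℕ.* x)) p)) (a≡a%ℕn+[a/ℕn]*n a p)
        (lemma (+ x * + x) a (+ (x ℕ.* x ℕ.% p)) (+ (a %ℕ p)) (+ (x ℕ.* x ℕ./ p)) (a /ℕ p) P)))
    where
    lemma : ∀ s a r r′ u v P → r - r′
      ≡ 1ℤ * (s - a) + (v - u) * P + -1ℤ * (s - (r + u * P)) + 1ℤ * (a - (r′ + v * P))
    lemma = solve-∀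

  %≡0⇒P∣ : ∀ a .{{_ : ℕ.NonZero p}} → a %ℕ p ≡ 0 → P ∣ a
  %≡0⇒P∣ a eq = divides (a /ℕ p) (trans (a≡a%ℕn+[a/ℕn]*n a p)
    (trans (cong (λ r → + r + a /ℕ p * P) eq) (lemma (a /ℕ p * P))))
    where
    lemma : ∀ x → 0ℤ + x ≡ x
    lemma = solve-∀

  -- The Boolean search in `legendre` becomes a statement about squares modulo p. In `go` the
  -- modulus is generalised so that the successor clause of `legendre` reduces.
  legendre-spec : ∀ a → ¬ P ∣ a →
    (∃ λ x → P ∣ + x * + x - a) × legendre a p ≡ 1ℤ
    ⊎ (∀ x → x ℕ.< p → ¬ P ∣ + x * + x - a) × legendre a p ≡ -1ℤ
  legendre-spec a P∤a = go p refl
    where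
    go : ∀ n → p ≡ n →
      (∃ λ x → P ∣ + x * + x - a) × legendre a n ≡ 1ℤ
      ⊎ (∀ x → x ℕ.< p → ¬ P ∣ + x * + x - a) × legendre a n ≡ -1ℤ
    go zero    p≡0 with () ← trans (sym p≡0) p≡2h+1
    go (suc n) refl with a %ℕ suc n in r≡
    ... | zero = contradiction (%≡0⇒P∣ a r≡) P∤a
    ... | suc r with any (λ x → ((x ℕ.* x) ℕ.% suc n) ℕ.≡ᵇ suc r) (upTo (suc n)) in found
    ... | true  with find (any⁻ _ (upTo (suc n)) (subst T (sym found) tt))
    ...   | x , _ , eq = inj₁ ((x , square-residue⇒∣ a x (trans (ℕ.≡ᵇ⇒≡ _ _ eq) (sym r≡))) , refl)
    go (suc n) refl | suc r | false = inj₂ (none , refl)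
      where
      none : ∀ x → x ℕ.< suc n → ¬ P ∣ + x * + x - a
      none x x<p P∣ = subst T found (any⁺ (λ x → ((x ℕ.* x) ℕ.% suc n) ℕ.≡ᵇ suc r) (lose (∈-upTo⁺ x<p)
        (ℕ.≡⇒≡ᵇ _ _ (trans (∣⇒square-residue a x P∣) r≡))))

  -- The mismatched cases are impossible: a square with aʰ ≡ -1 would give p ∣ 2, and a nonsquare
  -- with aʰ ≡ 1 contradicts `^h≡1⇒square`.
  euler : ∀ a n → ¬ P ∣ a → P ∣ a ^ h - -1ℤ ^ n → legendre a p ≡ -1ℤ ^ n
  euler a n P∤a P∣ with legendre-spec a P∤a | -1^-cases n
  ... | inj₁ (_ , eq)       | inj₁ s = trans eq (sym s)
  ... | inj₂ (_ , eq)       | inj₂ s = trans eq (sym s)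
  ... | inj₁ ((x , P∣x) , _) | inj₂ s =
    contradiction
      (∣-combine₂ 1ℤ -1ℤ (subst (λ z → P ∣ a ^ h - z) s P∣) (square⇒^h≡1 a x P∤a P∣x) (lemma (a ^ h)))
      P∤2
    where
    lemma : ∀ x → + 2 ≡ 1ℤ * (x - -1ℤ) + -1ℤ * (x - 1ℤ)
    lemma = solve-∀
  ... | inj₂ (none , _)     | inj₁ s =
    contradiction none (^h≡1⇒square a (subst (λ z → P ∣ a ^ h - z) s P∣))

  P∤factorial : ∀ n → n ℕ.< p → ¬ P ∣ factorial n
  P∤factorial zero    0<p = P∤small 0 (ℕ.≤-<-trans 0<h (subst (h ℕ.<_) (sym p≡2h+1) (s≤s (ℕ.m≤m+n h h))))
  P∤factorial (suc n) n<p = P∤* (P∤small n n<p) (P∤factorial n (ℕ.<⇒≤ n<p))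

  -- Since 2h = p - 1, the doubled factors 2h, 2(h-1), ..., 2(q+1) of (q+t)!/q! are -1, -3, ...,
  -- -(2t-1) modulo p.
  gauss : ∀ t q → h ≡ q ℕ.+ t →
    P ∣ (+ 2) ^ t * factorial (q ℕ.+ t) - -1ℤ ^ t * oddFactorial t * factorial q
  gauss zero    q _  = divides 0ℤ
    (trans (cong (λ k → 1ℤ * factorial k - 1ℤ * 1ℤ * factorial q) (ℕ.+-identityʳ q))
           (lemma (factorial q)))
    where
    lemma : ∀ x → 1ℤ * x - 1ℤ * 1ℤ * x ≡ 0ℤ
    lemma = solve-∀
  gauss (suc t) q h≡ =
    ∣-combine₂ (+ 2) (-1ℤ ^ t * oddFactorial t * factorial q)
      (gauss t (suc q) (trans h≡ (ℕ.+-suc q t))) ∣-refl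
      (trans
        (cong (λ k → (+ 2) * (+ 2) ^ t * factorial k
                     - -1ℤ * -1ℤ ^ t * oddFactorial (suc t) * factorial q) (ℕ.+-suc q t))
        (combine₁ (- (-1ℤ ^ t * oddFactorial t * factorial q)) P≡
          (lemma P (+ q) (+ t) ((+ 2) ^ t) (factorial (suc q ℕ.+ t)) (-1ℤ ^ t) (oddFactorial t)
            (factorial q))))
    where
    P≡ : P ≡ 1ℤ + ((+ q + (1ℤ + + t)) + (+ q + (1ℤ + + t)))
    P≡ = cong +_ (trans p≡2h+1 (cong (λ h → suc (h ℕ.+ h)) h≡))
    lemma : ∀ P q t a f s o g →
      (+ 2) * a * f - -1ℤ * s * ((1ℤ + (t + t)) * o) * g
      ≡ (+ 2) * (a * f - s * o * ((1ℤ + q) * g)) + s * o * g * P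
        + - (s * o * g) * (P - (1ℤ + ((q + (1ℤ + t)) + (q + (1ℤ + t)))))
    lemma = solve-∀

  -- Multiplying `gauss` by 2^q and using the even-odd splitting of h! gives 2ʰ h! ≡ (-1)ᵗ h!. Hence
  -- 2ʰ ≡ (-1)ᵗ and (-2)ʰ ≡ (-1)^(h+t) = (-1)^q.
  -2^h : ∀ q t → h ≡ q ℕ.+ t → factorial (q ℕ.+ t) ≡ (+ 2) ^ q * factorial q * oddFactorial t →
         P ∣ (- (+ 2)) ^ h - -1ℤ ^ q
  -2^h q t h≡ fact≡ =
    P-cancel (factorial (q ℕ.+ t)) (P∤factorial (q ℕ.+ t) (subst (ℕ._< p) h≡ h<p))
      (∣-combine₁ (-1ℤ ^ q * -1ℤ ^ t * (+ 2) ^ q) (gauss t q h≡)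
        (combine₁ (factorial (q ℕ.+ t)) power
          (combine₂ (- -1ℤ ^ q) (-1ℤ ^ q * (+ 2) ^ q * factorial q * oddFactorial t) fact≡ (-1^-square t)
            (lemma ((- (+ 2)) ^ h) ((+ 2) ^ q) ((+ 2) ^ t) (-1ℤ ^ q) (-1ℤ ^ t)
              (factorial (q ℕ.+ t)) (factorial q) (oddFactorial t)))))
    where
    lemma : ∀ n a b s u F f o → F * (n - s)
      ≡ s * u * a * (b * F - u * o * f) + F * (n - s * u * (a * b))
        + - s * (F - a * f * o) + s * a * f * o * (u * u - 1ℤ)
    lemma = solve-∀
    h<p : h ℕ.< p
    h<p = subst (h ℕ.<_) (sym p≡2h+1) (s≤s (ℕ.m≤m+n h h))
    power : (- (+ 2)) ^ h ≡ -1ℤ ^ q * -1ℤ ^ t * ((+ 2) ^ q * (+ 2) ^ t)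
    power = begin
      (- (+ 2)) ^ h ≡⟨ *-^ -1ℤ (+ 2) h ⟩
      -1ℤ ^ h * (+ 2) ^ h ≡⟨ cong (λ k → -1ℤ ^ k * (+ 2) ^ k) h≡ ⟩
      -1ℤ ^ (q ℕ.+ t) * (+ 2) ^ (q ℕ.+ t)
        ≡⟨ cong₂ _*_ (^-distribˡ-+-* -1ℤ q t) (^-distribˡ-+-* (+ 2) q t) ⟩
      -1ℤ ^ q * -1ℤ ^ t * ((+ 2) ^ q * (+ 2) ^ t) ∎
      where open ≡-Reasoning

-- Coefficients of rational polynomials

fromℚᵘ-homo-+ : ∀ x y → fromℚᵘ x ℚ.+ fromℚᵘ y ≡ fromℚᵘ (x ℚᵘ.+ y)
fromℚᵘ-homo-+ x y = ℚ.toℚᵘ-injective (ℚᵘ.≃-trans (ℚ.toℚᵘ-homo-+ (fromℚᵘ x) (fromℚᵘ y))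
  (ℚᵘ.≃-trans (ℚᵘ.+-cong (ℚ.toℚᵘ-fromℚᵘ x) (ℚ.toℚᵘ-fromℚᵘ y)) (ℚᵘ.≃-sym (ℚ.toℚᵘ-fromℚᵘ (x ℚᵘ.+ y)))))

fromℚᵘ-homo-* : ∀ x y → fromℚᵘ x ℚ.* fromℚᵘ y ≡ fromℚᵘ (x ℚᵘ.* y)
fromℚᵘ-homo-* x y = ℚ.toℚᵘ-injective (ℚᵘ.≃-trans (ℚ.toℚᵘ-homo-* (fromℚᵘ x) (fromℚᵘ y))
  (ℚᵘ.≃-trans (ℚᵘ.*-cong (ℚ.toℚᵘ-fromℚᵘ x) (ℚ.toℚᵘ-fromℚᵘ y)) (ℚᵘ.≃-sym (ℚ.toℚᵘ-fromℚᵘ (x ℚᵘ.* y)))))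

/-cross : ∀ x M y N .{{_ : ℕ.NonZero M}} .{{_ : ℕ.NonZero N}} → x * + N ≡ y * + M → x / M ≡ y / N
/-cross x (suc M) y (suc N) eq = ℚ.fromℚᵘ-cong {mkℚᵘ x M} {mkℚᵘ y N} (*≡* eq)

/-+ : ∀ x y M .{{_ : ℕ.NonZero M}} → x / M ℚ.+ y / M ≡ (x + y) / M
/-+ x y (suc M) = trans (fromℚᵘ-homo-+ (mkℚᵘ x M) (mkℚᵘ y M))
  (ℚ.fromℚᵘ-cong {mkℚᵘ x M ℚᵘ.+ mkℚᵘ y M} {mkℚᵘ (x + y) M}
    (*≡* (trans (lemma x y (+ suc M)) (cong ((x + y) *_) (sym (pos-* (suc M) (suc M)))))))
  where
  lemma : ∀ x y m → (x * m + y * m) * m ≡ (x + y) * (m * m)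
  lemma = solve-∀

/-* : ∀ x y M .{{_ : ℕ.NonZero M}} → x / M ℚ.* ℤtoℚ y ≡ (x * y) / M
/-* x y (suc M) = trans (fromℚᵘ-homo-* (mkℚᵘ x M) (mkℚᵘ y 0))
  (ℚ.fromℚᵘ-cong {mkℚᵘ x M ℚᵘ.* mkℚᵘ y 0} {mkℚᵘ (x * y) M}
    (*≡* (cong (λ n → x * y * + n) (sym (ℕ.*-identityʳ (suc M))))))

ℤtoℚ-neg : ∀ x → ℚ.- ℤtoℚ x ≡ ℤtoℚ (- x)
ℤtoℚ-neg x = begin
  ℚ.- ℤtoℚ x             ≡⟨ cong ℚ.-_ (ℚ.*-identityˡ (ℤtoℚ x)) ⟨
  ℚ.- (1ℚ ℚ.* ℤtoℚ x)    ≡⟨ ℚ.neg-distribˡ-* 1ℚ (ℤtoℚ x) ⟩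
  ℤtoℚ -1ℤ ℚ.* ℤtoℚ x    ≡⟨ /-* -1ℤ x 1 ⟩
  ℤtoℚ (-1ℤ * x)         ≡⟨ cong ℤtoℚ (lemma x) ⟩
  ℤtoℚ (- x)             ∎
  where
  open ≡-Reasoning
  lemma : ∀ x → -1ℤ * x ≡ - x
  lemma = solve-∀

coef : Poly → ℕ → ℚ
coef []      i       = 0ℚ
coef (a ∷ P) zero    = a
coef (a ∷ P) (suc i) = coef P i

coef-padd : ∀ P Q i → coef (padd P Q) i ≡ coef P i ℚ.+ coef Q i
coef-padd []      Q       i       = sym (ℚ.+-identityˡ (coef Q i))
coef-padd (a ∷ P) []      i       = sym (ℚ.+-identityʳ (coef (a ∷ P) i))
coef-padd (a ∷ P) (b ∷ Q) zero    = refl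
coef-padd (a ∷ P) (b ∷ Q) (suc i) = coef-padd P Q i

coef-pscale : ∀ c P i → coef (pscale c P) i ≡ c ℚ.* coef P i
coef-pscale c []      i       = sym (ℚ.*-zeroʳ c)
coef-pscale c (a ∷ P) zero    = refl
coef-pscale c (a ∷ P) (suc i) = coef-pscale c P i

coef-linear-zero : ∀ a b P → coef (pmul (a ∷ b ∷ []) P) 0 ≡ a ℚ.* coef P 0
coef-linear-zero a b P = begin
  coef (pmul (a ∷ b ∷ []) P) 0   ≡⟨ coef-padd (pscale a P) _ 0 ⟩
  coef (pscale a P) 0 ℚ.+ 0ℚ     ≡⟨ ℚ.+-identityʳ _ ⟩
  coef (pscale a P) 0            ≡⟨ coef-pscale a P 0 ⟩
  a ℚ.* coef P 0                 ∎
  where open ≡-Reasoning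

coef-linear-suc : ∀ a b P i →
  coef (pmul (a ∷ b ∷ []) P) (suc i) ≡ a ℚ.* coef P (suc i) ℚ.+ b ℚ.* coef P i
coef-linear-suc a b P i = begin
  coef (pmul (a ∷ b ∷ []) P) (suc i)
    ≡⟨ coef-padd (pscale a P) _ (suc i) ⟩
  coef (pscale a P) (suc i) ℚ.+ coef (padd (pscale b P) (0ℚ ∷ [])) i
    ≡⟨ cong₂ ℚ._+_ (coef-pscale a P (suc i)) (coef-padd (pscale b P) (0ℚ ∷ []) i) ⟩
  a ℚ.* coef P (suc i) ℚ.+ (coef (pscale b P) i ℚ.+ coef (0ℚ ∷ []) i)
    ≡⟨ cong (λ z → a ℚ.* coef P (suc i) ℚ.+ z) (cong₂ ℚ._+_ (coef-pscale b P i) (zeros i)) ⟩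
  a ℚ.* coef P (suc i) ℚ.+ (b ℚ.* coef P i ℚ.+ 0ℚ)
    ≡⟨ cong (λ z → a ℚ.* coef P (suc i) ℚ.+ z) (ℚ.+-identityʳ _) ⟩
  a ℚ.* coef P (suc i) ℚ.+ b ℚ.* coef P i ∎
  where
  open ≡-Reasoning
  zeros : ∀ i → coef (0ℚ ∷ []) i ≡ 0ℚ
  zeros zero    = refl
  zeros (suc i) = refl

coef-X^ : ∀ k i → coef (ppow X k) i ≡ ℤtoℚ (δ k i)
coef-X^ zero    zero    = refl
coef-X^ zero    (suc i) = refl
coef-X^ (suc k) zero    = trans (coef-linear-zero 0ℚ 1ℚ (ppow X k)) (ℚ.*-zeroˡ (coef (ppow X k) 0))
coef-X^ (suc k) (suc i) = begin
  coef (ppow X (suc k)) (suc i) ≡⟨ coef-linear-suc 0ℚ 1ℚ (ppow X k) i ⟩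
  0ℚ ℚ.* coef (ppow X k) (suc i) ℚ.+ 1ℚ ℚ.* coef (ppow X k) i
    ≡⟨ cong₂ ℚ._+_ (ℚ.*-zeroˡ (coef (ppow X k) (suc i))) (ℚ.*-identityˡ (coef (ppow X k) i)) ⟩
  0ℚ ℚ.+ coef (ppow X k) i ≡⟨ ℚ.+-identityˡ _ ⟩
  coef (ppow X k) i ≡⟨ coef-X^ k i ⟩
  ℤtoℚ (δ k i) ∎
  where open ≡-Reasoning

coef-1-X^ : ∀ k i → coef (ppow 1-X k) i ≡ ℤtoℚ (E k i)
coef-1-X^ zero    zero    = refl
coef-1-X^ zero    (suc i) = refl
coef-1-X^ (suc k) zero    =
  trans (coef-linear-zero 1ℚ (ℚ.- 1ℚ) (ppow 1-X k)) (trans (ℚ.*-identityˡ _) (coef-1-X^ k 0))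
coef-1-X^ (suc k) (suc i) = begin
  coef (ppow 1-X (suc k)) (suc i) ≡⟨ coef-linear-suc 1ℚ (ℚ.- 1ℚ) (ppow 1-X k) i ⟩
  1ℚ ℚ.* coef (ppow 1-X k) (suc i) ℚ.+ ℚ.- 1ℚ ℚ.* coef (ppow 1-X k) i
    ≡⟨ cong₂ (λ x y → 1ℚ ℚ.* x ℚ.+ ℚ.- 1ℚ ℚ.* y) (coef-1-X^ k (suc i)) (coef-1-X^ k i) ⟩
  1ℚ ℚ.* ℤtoℚ (E k (suc i)) ℚ.+ ℚ.- 1ℚ ℚ.* ℤtoℚ (E k i)
    ≡⟨ cong₂ ℚ._+_ (/-* 1ℤ (E k (suc i)) 1) (/-* -1ℤ (E k i) 1) ⟩
  ℤtoℚ (1ℤ * E k (suc i)) ℚ.+ ℤtoℚ (-1ℤ * E k i)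
    ≡⟨ /-+ (1ℤ * E k (suc i)) (-1ℤ * E k i) 1 ⟩
  ℤtoℚ (1ℤ * E k (suc i) + -1ℤ * E k i)
    ≡⟨ cong ℤtoℚ (lemma (E k (suc i)) (E k i)) ⟩
  ℤtoℚ (E k (suc i) - E k i) ∎
  where
  open ≡-Reasoning
  lemma : ∀ x y → 1ℤ * x + -1ℤ * y ≡ x - y
  lemma = solve-∀

-- A common denominator M reduces the rational sum to an integer sum of numerators.
coef-psum : ∀ f i (x : ℕ → ℤ) M .{{_ : ℕ.NonZero M}} n →
  (∀ k → k ℕ.< n → coef (f k) i ≡ x k / M) → coef (psum f n) i ≡ ∑ x n / M
coef-psum f i x M zero    _  = /-cross 0ℤ 1 0ℤ M refl
coef-psum f i x M (suc n) eq =
  trans (coef-padd (psum f n) (f n) i)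
    (trans (cong₂ ℚ._+_ (coef-psum f i x M n λ k k<n → eq k (ℕ.m<n⇒m<1+n k<n)) (eq n ℕ.≤-refl))
           (/-+ (∑ x n) (x n) M))

coef-term : ∀ {c} b M .{{_ : ℕ.NonZero M}} e k i → c ≡ b / M →
  coef (pscale c (padd (ppow X k) (pscale (ℤtoℚ e) (ppow 1-X k)))) i ≡ (b * (δ k i + e * E k i)) / M
coef-term {c} b M e k i c≡ = begin
  coef (pscale c (padd (ppow X k) (pscale (ℤtoℚ e) (ppow 1-X k)))) i
    ≡⟨ coef-pscale c (padd (ppow X k) (pscale (ℤtoℚ e) (ppow 1-X k))) i ⟩
  c ℚ.* coef (padd (ppow X k) (pscale (ℤtoℚ e) (ppow 1-X k))) i
    ≡⟨ cong₂ ℚ._*_ c≡ (coef-padd (ppow X k) _ i) ⟩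
  b / M ℚ.* (coef (ppow X k) i ℚ.+ coef (pscale (ℤtoℚ e) (ppow 1-X k)) i)
    ≡⟨ cong₂ (λ x y → b / M ℚ.* (x ℚ.+ y)) (coef-X^ k i)
         (trans (coef-pscale (ℤtoℚ e) (ppow 1-X k) i) (cong (ℤtoℚ e ℚ.*_) (coef-1-X^ k i))) ⟩
  b / M ℚ.* (ℤtoℚ (δ k i) ℚ.+ ℤtoℚ e ℚ.* ℤtoℚ (E k i))
    ≡⟨ cong (λ y → b / M ℚ.* (ℤtoℚ (δ k i) ℚ.+ y)) (/-* e (E k i) 1) ⟩
  b / M ℚ.* (ℤtoℚ (δ k i) ℚ.+ ℤtoℚ (e * E k i))
    ≡⟨ cong (b / M ℚ.*_) (/-+ (δ k i) (e * E k i) 1) ⟩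
  b / M ℚ.* ℤtoℚ (δ k i + e * E k i)
    ≡⟨ /-* b (δ k i + e * E k i) M ⟩
  (b * (δ k i + e * E k i)) / M ∎
  where open ≡-Reasoning

All-coef : ∀ {Q : ℚ → Set} P → (∀ i → Q (coef P i)) → All Q P
All-coef []      Q-coef = []
All-coef (a ∷ P) Q-coef = Q-coef 0 ∷ All-coef P (λ i → Q-coef (suc i))

module _ {p : ℕ} (p-prime : Prime p) where

  p∤^ : ∀ {m} → ¬ p ℕ.∣ m → ∀ n → ¬ p ℕ.∣ m ℕ.^ n
  p∤^ p∤m zero    p∣1 = contradiction (subst Prime (ℕ.∣1⇒≡1 p∣1) p-prime) ¬prime[1]
  p∤^ {m} p∤m (suc n) p∣ with euclidsLemma m (m ℕ.^ n) p-prime p∣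
  ... | inj₁ p∣m  = p∤m p∣m
  ... | inj₂ p∣mⁿ = p∤^ p∤m n p∣mⁿ

  ∣⇒ZeroModP² : ∀ {c x M} .{{_ : ℕ.NonZero M}} → ¬ p ℕ.∣ M → + p * + p ∣ x → c ≡ x / M → ZeroModP² p c
  ∣⇒ZeroModP² {M = suc M} p∤M (divides z refl) c≡ = z , suc M , _ , p∤M , trans c≡
    -- The denominator M serves as witness unreduced; `p ^ 2` unfolds to p * (p * 1).
    (cong (_/ suc M) (cong (z *_) (trans (sym (pos-* p p)) (cong (λ k → + (p ℕ.* k)) (sym (ℕ.*-identityʳ p))))))

-- The counterpart of `E-absorb` for the derivative of x^(k+1).
δ-absorb : ∀ k i → (1ℤ + + i) * δ k i ≡ (1ℤ + + k) * δ k i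
δ-absorb zero    zero    = refl
δ-absorb zero    (suc i) = *-zeroʳ (1ℤ + + suc i)
δ-absorb (suc k) zero    = sym (*-zeroʳ (1ℤ + + suc k))
δ-absorb (suc k) (suc i) = combine₁ 1ℤ (δ-absorb k i) (lemma (+ k) (+ i) (δ k i))
  where
  lemma : ∀ k i d → (1ℤ + (1ℤ + i)) * d ≡ (1ℤ + (1ℤ + k)) * d + 1ℤ * ((1ℤ + i) * d - (1ℤ + k) * d)
  lemma = solve-∀

-- From integer numerators to the rational sums.

module Congruences
  {p : ℕ} (p-prime : Prime p) (2<p : 2 ℕ.< p)
  (A : ℕ → ℕ) (m K e L : ℕ) .{{m≢0 : ℕ.NonZero m}} (m≡Ke : m ≡ K ℕ.* e)
  (A₀≡1 : A 0 ≡ 1)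
  (A-rec : ∀ k → A (suc k) ℕ.* ((1 ℕ.+ k) ℕ.* (1 ℕ.+ k)) ≡ e ℕ.* (K ℕ.* (k ℕ.* (1 ℕ.+ k)) ℕ.+ L) ℕ.* A k)
  (m-unit : ¬ + p ∣ + m) (K-unit : ¬ + p ∣ + K)
  (q : ℕ) (q<p : q ℕ.< p)
  (root : + p ∣ + K * (+ q * (1ℤ + + q)) + + L)
  (nonroot : ∀ k → k ℕ.< q → ¬ + p ∣ + K * (+ k * (1ℤ + + k)) + + L)
  where

  M : ℕ
  M = m ℕ.^ p

  instance
    M≢0 : ℕ.NonZero M
    M≢0 = ℕ.m^n≢0 m p

  p∤M : ¬ p ℕ.∣ M
  p∤M = p∤^ p-prime (λ p∣m → m-unit (∣ᵤ⇒∣ p∣m)) p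

  -- For k ≤ p, the numerator of A k / mᵏ over the common denominator mᵖ.
  B : ℕ → ℤ
  B k = + A k * + (m ℕ.^ (p ℕ.∸ k))

  -- The powers m^(p-k) and m^(p-k-1) differ by m = K e, which absorbs the e of the recurrence for
  -- `A` together with the factor K on the left.
  B-rec : ∀ k → k ℕ.< p →
    + K * ((1ℤ + + k) * (1ℤ + + k)) * B (suc k) ≡ (+ K * (+ k * (1ℤ + + k)) + + L) * B k
  B-rec k k<p =
    combine₁ (+ K * + (m ℕ.^ (p ℕ.∸ suc k))) A-recℤ
      (combine₁ (- (R * + A k)) power
        (lemma (+ K) (+ e) (+ k) (+ L) (+ A k) (+ A (suc k))
          (+ (m ℕ.^ (p ℕ.∸ suc k))) (+ (m ℕ.^ (p ℕ.∸ k)))))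
    where
    open ≡-Reasoning
    R : ℤ
    R = + K * (+ k * (1ℤ + + k)) + + L
    lemma : ∀ K e k L a a′ M′ M →
      K * ((1ℤ + k) * (1ℤ + k)) * (a′ * M′)
      ≡ (K * (k * (1ℤ + k)) + L) * (a * M)
        + K * M′ * (a′ * ((1ℤ + k) * (1ℤ + k)) - e * (K * (k * (1ℤ + k)) + L) * a)
        + - ((K * (k * (1ℤ + k)) + L) * a) * (M - K * e * M′)
    lemma = solve-∀
    A-recℤ : + A (suc k) * ((1ℤ + + k) * (1ℤ + + k)) ≡ + e * R * + A k
    A-recℤ = begin
      + A (suc k) * ((1ℤ + + k) * (1ℤ + + k))
        ≡⟨ cong (+ A (suc k) *_) (pos-* (suc k) (suc k)) ⟨
      + A (suc k) * + ((1 ℕ.+ k) ℕ.* (1 ℕ.+ k))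
        ≡⟨ pos-* (A (suc k)) _ ⟨
      + (A (suc k) ℕ.* ((1 ℕ.+ k) ℕ.* (1 ℕ.+ k)))
        ≡⟨ cong +_ (A-rec k) ⟩
      + (e ℕ.* (K ℕ.* (k ℕ.* (1 ℕ.+ k)) ℕ.+ L) ℕ.* A k)
        ≡⟨ trans (pos-* (e ℕ.* (K ℕ.* (k ℕ.* (1 ℕ.+ k)) ℕ.+ L)) (A k))
             (cong (_* + A k) (pos-* e (K ℕ.* (k ℕ.* (1 ℕ.+ k)) ℕ.+ L))) ⟩
      + e * (+ (K ℕ.* (k ℕ.* (1 ℕ.+ k))) + + L) * + A k
        ≡⟨ cong (λ z → + e * (z + + L) * + A k)
             (trans (pos-* K (k ℕ.* (1 ℕ.+ k))) (cong (+ K *_) (pos-* k (1 ℕ.+ k)))) ⟩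
      + e * R * + A k ∎
    power : + (m ℕ.^ (p ℕ.∸ k)) ≡ + K * + e * + (m ℕ.^ (p ℕ.∸ suc k))
    power = begin
      + (m ℕ.^ (p ℕ.∸ k))              ≡⟨ cong (λ n → + (m ℕ.^ n)) (ℕ.+-∸-assoc 1 k<p) ⟩
      + (m ℕ.* m ℕ.^ (p ℕ.∸ suc k))    ≡⟨ pos-* m _ ⟩
      + m * + (m ℕ.^ (p ℕ.∸ suc k))
        ≡⟨ cong (λ z → z * + (m ℕ.^ (p ℕ.∸ suc k))) (trans (cong +_ m≡Ke) (pos-* K e)) ⟩
      + K * + e * + (m ℕ.^ (p ℕ.∸ suc k)) ∎

  B₀-unit : ¬ + p ∣ B 0
  B₀-unit P∣ = p∤M (∣⇒∣ᵤ (subst (+ p ∣_) (trans (cong (λ a → + a * + M) A₀≡1) (lemma (+ M))) P∣))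
    where
    lemma : ∀ x → 1ℤ * x ≡ x
    lemma = solve-∀

  open Reflection p-prime 2<p (+ K) (+ L) B B-rec K-unit B₀-unit q q<p root nonroot

  -- M times the coefficient of xⁱ in the first sum.
  S⁻-coef : ℕ → ℤ
  S⁻-coef i = ∑ (λ k → B k * (δ k i + - σ * E k i)) p

  -- For i < p the coefficient is B i - σ G i = -σ (G i - σ B i), as σ² = 1; for i ≥ p every summand
  -- is zero by degree.
  P²∣S⁻-coef : ∀ i → + p * + p ∣ S⁻-coef i
  P²∣S⁻-coef i with ℕ.<-≤-connex i p
  ... | inj₁ i<p = ∣-combine₁ (- σ) (G≡σB i i<p)
    (trans equation (combine₁ (- B i) (-1^-square q) (lemma (B i) (G i) σ)))
    where
    open ≡-Reasoning
    lemma : ∀ b g s → b + - s * g ≡ - s * (g + - s * b) + - b * (s * s - 1ℤ)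
    lemma = solve-∀
    split : ∀ b d s e → b * (d + - s * e) ≡ b * d + - s * (b * e)
    split = solve-∀
    equation : S⁻-coef i ≡ B i + - σ * G i
    equation = begin
      S⁻-coef i ≡⟨ ∑-cong p (λ k _ → split (B k) (δ k i) σ (E k i)) ⟩
      ∑ (λ k → B k * δ k i + - σ * (B k * E k i)) p ≡⟨ ∑-distrib-+ _ _ p ⟩
      ∑ (λ k → B k * δ k i) p + ∑ (λ k → - σ * (B k * E k i)) p
        ≡⟨ cong₂ _+_ (∑-δ B p i<p) (sym (*-distribˡ-∑ (- σ) _ p)) ⟩
      B i + - σ * G i ∎
  ... | inj₂ p≤i = divides 0ℤ (trans (∑-cong p vanish) (∑-zero p))
    where
    lemma : ∀ b s → b * (0ℤ + - s * 0ℤ) ≡ 0ℤ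
    lemma = solve-∀
    vanish : ∀ k → k ℕ.< p → B k * (δ k i + - σ * E k i) ≡ 0ℤ
    vanish k k<p = trans (cong₂ (λ d z → B k * (d + - σ * z))
      (δ-< (ℕ.<-≤-trans k<p p≤i)) (E-< (ℕ.<-≤-trans k<p p≤i)))
      (lemma (B k) σ)

  -- At n = p - 1, M times the coefficient of xⁱ in the second sum; the free n lets `derivative`
  -- split on the number of terms.
  S⁺-coef : ℕ → ℕ → ℤ
  S⁺-coef n i = ∑ (λ j → (1ℤ + + j) * B (suc j) * (δ j i + σ * E j i)) n

  -- The second sum is the formal derivative of the first.
  P²∣S⁺-coef : ∀ i → + p * + p ∣ S⁺-coef (p ℕ.∸ 1) i
  P²∣S⁺-coef i = ∣-combine₁ (1ℤ + + i) (P²∣S⁻-coef (suc i)) (derivative p)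
    where
    open ≡-Reasoning
    lemma₀ : ∀ i b s → (1ℤ + i) * (b * (0ℤ + - s * 0ℤ)) ≡ 0ℤ
    lemma₀ = solve-∀
    lemma : ∀ i j b s d e e′ → (1ℤ + i) * (b * (d + - s * e′))
      ≡ (1ℤ + j) * b * (d + s * e) + b * ((1ℤ + i) * d - (1ℤ + j) * d)
        + - (b * s) * ((1ℤ + i) * e′ - - (1ℤ + j) * e)
    lemma = solve-∀
    derivative : ∀ n → S⁺-coef (n ℕ.∸ 1) i ≡ (1ℤ + + i) * ∑ (λ k → B k * (δ k (suc i) + - σ * E k (suc i))) n
    derivative zero    = sym (*-zeroʳ (1ℤ + + i))
    derivative (suc n) = sym (begin
      (1ℤ + + i) * ∑ (λ k → B k * (δ k (suc i) + - σ * E k (suc i))) (suc n)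
        ≡⟨ *-distribˡ-∑ (1ℤ + + i) _ (suc n) ⟩
      ∑ (λ k → (1ℤ + + i) * (B k * (δ k (suc i) + - σ * E k (suc i)))) (suc n)
        ≡⟨ ∑-suc _ n ⟩
      (1ℤ + + i) * (B 0 * (0ℤ + - σ * 0ℤ))
        + ∑ (λ j → (1ℤ + + i) * (B (suc j) * (δ j i + - σ * E (suc j) (suc i)))) n
        -- The constant term k = 0 differentiates to zero; the shift k = j + 1 handles the rest.
        ≡⟨ cong₂ _+_ (lemma₀ (+ i) (B 0) σ) (∑-cong n λ j _ →
             combine₂ (B (suc j)) (- (B (suc j) * σ)) (δ-absorb j i) (E-absorb j i)
               (lemma (+ i) (+ j) (B (suc j)) σ (δ j i) (E j i) (E (suc j) (suc i)))) ⟩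
      0ℤ + S⁺-coef n i
        ≡⟨ zeroˡ (S⁺-coef n i) ⟩
      S⁺-coef n i ∎)
      where
      zeroˡ : ∀ x → 0ℤ + x ≡ x
      zeroˡ = solve-∀

  a : ℕ → ℚ
  a k = frac (A k) m k

  a≡B/M : ∀ k → k ℕ.≤ p → a k ≡ B k / M
  a≡B/M k k≤p = /-cross (+ A k) (m ℕ.^ k) (B k) M {{ℕ.m^n≢0 m k}} (begin
    + A k * + (m ℕ.^ p) ≡⟨ cong (λ n → + A k * + (m ℕ.^ n)) (ℕ.m∸n+n≡m k≤p) ⟨
    + A k * + (m ℕ.^ (p ℕ.∸ k ℕ.+ k)) ≡⟨ cong (λ z → + A k * + z) (ℕ.^-distribˡ-+-* m (p ℕ.∸ k) k) ⟩
    + A k * + (m ℕ.^ (p ℕ.∸ k) ℕ.* m ℕ.^ k) ≡⟨ cong (+ A k *_) (pos-* (m ℕ.^ (p ℕ.∸ k)) (m ℕ.^ k)) ⟩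
    + A k * (+ (m ℕ.^ (p ℕ.∸ k)) * + (m ℕ.^ k)) ≡⟨ lemma (+ A k) (+ (m ℕ.^ (p ℕ.∸ k))) (+ (m ℕ.^ k)) ⟩
    B k * + (m ℕ.^ k) ∎)
    where
    open ≡-Reasoning
    lemma : ∀ x y z → x * (y * z) ≡ x * y * z
    lemma = solve-∀

  S⁻-congruence : ∀ {ε} → ε ≡ σ → PolyZeroModP² p (S⁻ a (ℤtoℚ ε) p)
  S⁻-congruence refl = All-coef _ λ i → ∣⇒ZeroModP² p-prime p∤M (P²∣S⁻-coef i)
    (coef-psum _ i _ M p λ k k<p →
      trans (cong (λ z → coef (pscale (a k) (padd (ppow X k) (pscale z (ppow 1-X k)))) i) (ℤtoℚ-neg σ))
            (coef-term (B k) M (- σ) k i (a≡B/M k (ℕ.<⇒≤ k<p))))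

  S⁺-congruence : ∀ {ε} → ε ≡ σ → PolyZeroModP² p (S⁺ a (ℤtoℚ ε) p)
  S⁺-congruence refl = All-coef _ λ i → ∣⇒ZeroModP² p-prime p∤M (P²∣S⁺-coef i)
    (coef-psum _ i _ M (p ℕ.∸ 1) λ j j<p-1 → coef-term ((1ℤ + + j) * B (suc j)) M σ j i (begin
      ℤtoℚ (+ suc j) ℚ.* a (suc j)       ≡⟨ ℚ.*-comm (ℤtoℚ (+ suc j)) (a (suc j)) ⟩
      a (suc j) ℚ.* ℤtoℚ (+ suc j)
        ≡⟨ cong (ℚ._* ℤtoℚ (+ suc j)) (a≡B/M (suc j) (ℕ.≤-trans j<p-1 (ℕ.m∸n≤m p 1))) ⟩
      B (suc j) / M ℚ.* ℤtoℚ (+ suc j)   ≡⟨ /-* (B (suc j)) (+ suc j) M ⟩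
      (B (suc j) * + suc j) / M          ≡⟨ cong (_/ M) (lemma (B (suc j)) (+ suc j)) ⟩
      (+ suc j * B (suc j)) / M          ∎))
    where
    open ≡-Reasoning
    lemma : ∀ x y → x * y ≡ y * x
    lemma = solve-∀

-- The three families

-1^-even : ∀ n → -1ℤ ^ (n ℕ.+ n) ≡ 1ℤ
-1^-even n = trans (^-distribˡ-+-* -1ℤ n n) (-1^-square n)

parity : ∀ n → (∃ λ k → n ≡ k ℕ.+ k) ⊎ (∃ λ k → n ≡ suc (k ℕ.+ k))
parity zero = inj₁ (0 , refl)
parity (suc n) with parity n
... | inj₁ (k , refl) = inj₂ (k , refl)
... | inj₂ (k , refl) = inj₁ (suc k , cong suc (sym (ℕ.+-suc k k)))

-- With d = c + 2, the hypotheses say p = qd + 1 or p = qd + d - 1; for d = 3, 4, 6 these are the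
-- residues prime to d.
module Quadratic
  {p : ℕ} (p-prime : Prime p) (c q r : ℕ)
  (p≡ : p ≡ suc r ℕ.+ q ℕ.* (2 ℕ.+ c)) (r≡ : r ≡ 0 ⊎ r ≡ c)
  where

  open PrimeDivisibility p-prime

  private
    R : ℕ → ℤ
    R k = + ((2 ℕ.+ c) ℕ.* (2 ℕ.+ c)) * (+ k * (1ℤ + + k)) + + suc c

  R-factors : ∀ k → R k ≡ + suc (k ℕ.* (2 ℕ.+ c)) * + suc (c ℕ.+ k ℕ.* (2 ℕ.+ c))
  R-factors k = begin
    R k
      ≡⟨ cong (λ z → z * (+ k * (1ℤ + + k)) + + suc c) (pos-* (2 ℕ.+ c) (2 ℕ.+ c)) ⟩
    (+ 2 + + c) * (+ 2 + + c) * (+ k * (1ℤ + + k)) + (1ℤ + + c)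
      ≡⟨ lemma (+ c) (+ k) ⟩
    (1ℤ + + k * (+ 2 + + c)) * (1ℤ + (+ c + + k * (+ 2 + + c)))
      ≡⟨ cong (λ z → (1ℤ + z) * (1ℤ + (+ c + z))) (pos-* k (2 ℕ.+ c)) ⟨
    + suc (k ℕ.* (2 ℕ.+ c)) * + suc (c ℕ.+ k ℕ.* (2 ℕ.+ c)) ∎
    where
    open ≡-Reasoning
    lemma : ∀ c k → (+ 2 + c) * (+ 2 + c) * (k * (1ℤ + k)) + (1ℤ + c)
      ≡ (1ℤ + k * (+ 2 + c)) * (1ℤ + (c + k * (+ 2 + c)))
    lemma = solve-∀

  -- One of the two factors of R q is p itself.
  root : P ∣ R q
  root = subst (P ∣_) (sym (R-factors q)) (factor r≡)
    where
    P∣suc : ∀ s → r ≡ s → P ∣ + suc (s ℕ.+ q ℕ.* (2 ℕ.+ c))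
    P∣suc s refl = subst (λ n → P ∣ + n) p≡ ∣-refl
    factor : r ≡ 0 ⊎ r ≡ c → P ∣ + suc (q ℕ.* (2 ℕ.+ c)) * + suc (c ℕ.+ q ℕ.* (2 ℕ.+ c))
    factor (inj₁ r≡0) = ∣m⇒∣m*n (+ suc (c ℕ.+ q ℕ.* (2 ℕ.+ c))) (P∣suc 0 r≡0)
    factor (inj₂ r≡c) = ∣n⇒∣m*n (+ suc (q ℕ.* (2 ℕ.+ c))) (P∣suc c r≡c)

  qd<p : q ℕ.* (2 ℕ.+ c) ℕ.< p
  qd<p = subst (q ℕ.* (2 ℕ.+ c) ℕ.<_) (sym p≡) (s≤s (ℕ.m≤n+m _ r))

  q<p : q ℕ.< p
  q<p = ℕ.≤-<-trans (ℕ.m≤m*n q (2 ℕ.+ c)) qd<p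

  -- Both factors of R k are positive and below p: kd + d - 1 < (k+1)d ≤ qd < p.
  nonroot : ∀ k → k ℕ.< q → ¬ P ∣ R k
  nonroot k k<q P∣R =
    P∤* (P∤small _ (ℕ.≤-<-trans (s≤s (ℕ.m≤n+m _ c)) large<p)) (P∤small _ large<p)
      (subst (P ∣_) (R-factors k) P∣R)
    where
    large<p : suc (c ℕ.+ k ℕ.* (2 ℕ.+ c)) ℕ.< p
    large<p = ℕ.<-trans (ℕ.n<1+n _) (ℕ.≤-<-trans (ℕ.*-monoˡ-≤ (2 ℕ.+ c) k<q) qd<p)

module _ {p : ℕ} (p-prime : Prime p) (3<p : 3 ℕ.< p) where

  open PrimeDivisibility p-prime

  proper∤p : ∀ {n} → 1 ℕ.< n → n ℕ.< p → ¬ n ℕ.∣ p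
  proper∤p 1<n n<p n∣p with prime⇒irreducible p-prime n∣p
  ... | inj₁ refl = ℕ.<-irrefl refl 1<n
  ... | inj₂ refl = ℕ.<-irrefl refl n<p

  2∤p : ∀ k → ¬ p ≡ k ℕ.* 2
  2∤p k p≡ = proper∤p ℕ.≤-refl (ℕ.<⇒≤ 3<p) (ℕ.divides k p≡)

  3∤p : ∀ k → ¬ p ≡ k ℕ.* 3
  3∤p k p≡ = proper∤p (s≤s (s≤s z≤n)) 3<p (ℕ.divides k p≡)

  P∤2 : ¬ P ∣ + 2
  P∤2 = P∤small 1 (ℕ.<⇒≤ 3<p)

  P∤3 : ¬ P ∣ + 3
  P∤3 = P∤small 2 3<p

  -- For d = c + 2, q is the quotient and r + 1 the remainder of p by d; ε is the symbol to be
  -- identified with the reflection sign.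
  Residue : ℕ → ℤ → Set
  Residue c ε = ∃ λ q → ∃ λ r → p ≡ suc r ℕ.+ q ℕ.* (2 ℕ.+ c) × (r ≡ 0 ⊎ r ≡ c) × ε ≡ -1ℤ ^ q

  -- As p is odd, p = 3q + 1 forces q even and p = 3q + 2 forces q odd.
  residue₃ : Residue 1 (legendre (+ p) 3)
  residue₃ = go (p ℕ.% 3) (p ℕ./ 3) refl (ℕ.m≡m%n+[m/n]*n p 3) (ℕ.m%n<n p 3)
    where
    one : ∀ n → n ℕ.% 3 ≡ 1 → legendre (+ n) 3 ≡ 1ℤ
    one n eq rewrite eq = refl
    two : ∀ n → n ℕ.% 3 ≡ 2 → legendre (+ n) 3 ≡ -1ℤ
    two n eq rewrite eq = refl
    sign₁ : ∀ q → p ≡ 1 ℕ.+ q ℕ.* 3 → 1ℤ ≡ -1ℤ ^ q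
    sign₁ q p≡ with parity q
    ... | inj₁ (k , refl) = sym (-1^-even k)
    ... | inj₂ (k , refl) = contradiction (trans p≡ (lemma k)) (2∤p (2 ℕ.+ k ℕ.* 3))
      where
      lemma : ∀ k → 1 ℕ.+ (1 ℕ.+ (k ℕ.+ k)) ℕ.* 3 ≡ (2 ℕ.+ k ℕ.* 3) ℕ.* 2
      lemma = ℕ-Solver.solve-∀
    sign₂ : ∀ q → p ≡ 2 ℕ.+ q ℕ.* 3 → -1ℤ ≡ -1ℤ ^ q
    sign₂ q p≡ with parity q
    ... | inj₂ (k , refl) = sym (cong (-1ℤ *_) (-1^-even k))
    ... | inj₁ (k , refl) = contradiction (trans p≡ (lemma k)) (2∤p (1 ℕ.+ k ℕ.* 3))
      where
      lemma : ∀ k → 2 ℕ.+ (k ℕ.+ k) ℕ.* 3 ≡ (1 ℕ.+ k ℕ.* 3) ℕ.* 2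
      lemma = ℕ-Solver.solve-∀
    go : ∀ r q → p ℕ.% 3 ≡ r → p ≡ r ℕ.+ q ℕ.* 3 → r ℕ.< 3 → Residue 1 (legendre (+ p) 3)
    go 0 q _  p≡ _ = contradiction p≡ (3∤p q)
    go 1 q r≡ p≡ _ = q , 0 , p≡ , inj₁ refl , trans (one p r≡) (sign₁ q p≡)
    go 2 q r≡ p≡ _ = q , 1 , p≡ , inj₂ refl , trans (two p r≡) (sign₂ q p≡)
    go (suc (suc (suc _))) q _ p≡ (s≤s (s≤s (s≤s ())))

  -- Among 1, ..., h there are q even and t odd numbers: t = q if p = 4q + 1, and t = q + 1 if p =
  -- 4q + 3.
  residue₄ : Residue 2 (legendre (- (+ 2)) p)
  residue₄ = go (p ℕ.% 4) (p ℕ./ 4) (ℕ.m≡m%n+[m/n]*n p 4) (ℕ.m%n<n p 4)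
    where
    P∤-2 : ¬ P ∣ - (+ 2)
    P∤-2 P∣ = P∤2 (∣m⇒∣-m P∣)
    even₀ : ∀ q → q ℕ.* 4 ≡ (q ℕ.* 2) ℕ.* 2
    even₀ = ℕ-Solver.solve-∀
    even₂ : ∀ q → 2 ℕ.+ q ℕ.* 4 ≡ (1 ℕ.+ q ℕ.* 2) ℕ.* 2
    even₂ = ℕ-Solver.solve-∀
    odd₁ : ∀ q → 1 ℕ.+ q ℕ.* 4 ≡ 1 ℕ.+ ((q ℕ.+ q) ℕ.+ (q ℕ.+ q))
    odd₁ = ℕ-Solver.solve-∀
    odd₃ : ∀ q → 3 ℕ.+ q ℕ.* 4 ≡ 1 ℕ.+ ((q ℕ.+ (1 ℕ.+ q)) ℕ.+ (q ℕ.+ (1 ℕ.+ q)))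
    odd₃ = ℕ-Solver.solve-∀
    symbol : ∀ q t → p ≡ suc ((q ℕ.+ t) ℕ.+ (q ℕ.+ t)) →
      factorial (q ℕ.+ t) ≡ (+ 2) ^ q * factorial q * oddFactorial t → legendre (- (+ 2)) p ≡ -1ℤ ^ q
    symbol q t p≡ fact≡ = euler (- (+ 2)) q P∤-2 (-2^h q t refl fact≡)
      where open OddPrime p-prime (q ℕ.+ t) p≡
    go : ∀ r q → p ≡ r ℕ.+ q ℕ.* 4 → r ℕ.< 4 → Residue 2 (legendre (- (+ 2)) p)
    go 0 q p≡ _ = contradiction (trans p≡ (even₀ q)) (2∤p (q ℕ.* 2))
    go 1 q p≡ _ = q , 0 , p≡ , inj₁ refl , symbol q q (trans p≡ (odd₁ q)) (factorial-even q)
    go 2 q p≡ _ = contradiction (trans p≡ (even₂ q)) (2∤p (1 ℕ.+ q ℕ.* 2))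
    go 3 q p≡ _ = q , 2 , p≡ , inj₂ refl , symbol q (suc q) (trans p≡ (odd₃ q))
      (trans (cong factorial (ℕ.+-suc q q)) (factorial-odd q))
    go (suc (suc (suc (suc _)))) q p≡ (s≤s (s≤s (s≤s (s≤s ()))))

  -- Euler's criterion gives (-1)ʰ, and h = q + 2t has the parity of q: t = q if p = 6q + 1, and t =
  -- q + 1 if p = 6q + 5.
  residue₆ : Residue 4 (legendre (- (+ 1)) p)
  residue₆ = go (p ℕ.% 6) (p ℕ./ 6) (ℕ.m≡m%n+[m/n]*n p 6) (ℕ.m%n<n p 6)
    where
    even₀ : ∀ q → q ℕ.* 6 ≡ (q ℕ.* 3) ℕ.* 2
    even₀ = ℕ-Solver.solve-∀
    even₂ : ∀ q → 2 ℕ.+ q ℕ.* 6 ≡ (1 ℕ.+ q ℕ.* 3) ℕ.* 2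
    even₂ = ℕ-Solver.solve-∀
    triple₃ : ∀ q → 3 ℕ.+ q ℕ.* 6 ≡ (1 ℕ.+ q ℕ.* 2) ℕ.* 3
    triple₃ = ℕ-Solver.solve-∀
    even₄ : ∀ q → 4 ℕ.+ q ℕ.* 6 ≡ (2 ℕ.+ q ℕ.* 3) ℕ.* 2
    even₄ = ℕ-Solver.solve-∀
    odd₁ : ∀ q → 1 ℕ.+ q ℕ.* 6 ≡ 1 ℕ.+ ((q ℕ.+ (q ℕ.+ q)) ℕ.+ (q ℕ.+ (q ℕ.+ q)))
    odd₁ = ℕ-Solver.solve-∀
    odd₅ : ∀ q → 5 ℕ.+ q ℕ.* 6
      ≡ 1 ℕ.+ ((q ℕ.+ ((1 ℕ.+ q) ℕ.+ (1 ℕ.+ q))) ℕ.+ (q ℕ.+ ((1 ℕ.+ q) ℕ.+ (1 ℕ.+ q))))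
    odd₅ = ℕ-Solver.solve-∀
    symbol : ∀ q t → p ≡ suc ((q ℕ.+ (t ℕ.+ t)) ℕ.+ (q ℕ.+ (t ℕ.+ t))) → legendre -1ℤ p ≡ -1ℤ ^ q
    symbol q t p≡ = trans
      (euler -1ℤ h (λ P∣ → P∤small 0 (ℕ.<⇒≤ (ℕ.<⇒≤ 3<p)) (∣m⇒∣-m P∣)) (divides 0ℤ (lemma (-1ℤ ^ h))))
      (trans (^-distribˡ-+-* -1ℤ q (t ℕ.+ t)) (trans (cong (-1ℤ ^ q *_) (-1^-even t)) (*-identityʳ _)))
      where
      h : ℕ
      h = q ℕ.+ (t ℕ.+ t)
      open OddPrime p-prime h p≡
      lemma : ∀ x → x - x ≡ 0ℤ
      lemma = solve-∀
    go : ∀ r q → p ≡ r ℕ.+ q ℕ.* 6 → r ℕ.< 6 → Residue 4 (legendre -1ℤ p)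
    go 0 q p≡ _ = contradiction (trans p≡ (even₀ q)) (2∤p (q ℕ.* 3))
    go 1 q p≡ _ = q , 0 , p≡ , inj₁ refl , symbol q q (trans p≡ (odd₁ q))
    go 2 q p≡ _ = contradiction (trans p≡ (even₂ q)) (2∤p (1 ℕ.+ q ℕ.* 3))
    go 3 q p≡ _ = contradiction (trans p≡ (triple₃ q)) (3∤p (1 ℕ.+ q ℕ.* 2))
    go 4 q p≡ _ = contradiction (trans p≡ (even₄ q)) (2∤p (2 ℕ.+ q ℕ.* 3))
    go 5 q p≡ _ = q , 4 , p≡ , inj₂ refl , symbol q (suc q) (trans p≡ (odd₅ q))
    go (suc (suc (suc (suc (suc (suc _)))))) q p≡ (s≤s (s≤s (s≤s (s≤s (s≤s (s≤s ()))))))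

  -- The families of the theorem are c = 1, 2, 4, i.e. d = c + 2 = 3, 4, 6.
  family : ∀ c {ε} (A : ℕ → ℕ) (e m : ℕ) .{{_ : ℕ.NonZero m}} → Residue c ε →
    m ≡ (2 ℕ.+ c) ℕ.* (2 ℕ.+ c) ℕ.* e → A 0 ≡ 1 →
    (∀ k → A (suc k) ℕ.* ((1 ℕ.+ k) ℕ.* (1 ℕ.+ k))
           ≡ e ℕ.* ((2 ℕ.+ c) ℕ.* (2 ℕ.+ c) ℕ.* (k ℕ.* (1 ℕ.+ k)) ℕ.+ suc c) ℕ.* A k) →
    ¬ P ∣ + m → ¬ P ∣ + ((2 ℕ.+ c) ℕ.* (2 ℕ.+ c)) →
    PolyZeroModP² p (S⁻ (λ k → frac (A k) m k) (ℤtoℚ ε) p)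
    × PolyZeroModP² p (S⁺ (λ k → frac (A k) m k) (ℤtoℚ ε) p)
  family c A e m (q , r , p≡ , r≡ , ε≡) m≡ A₀≡1 A-rec P∤m P∤K =
    S⁻-congruence ε≡ , S⁺-congruence ε≡
    where
    open Quadratic p-prime c q r p≡ r≡
    open Congruences p-prime (ℕ.<⇒≤ 3<p) A m ((2 ℕ.+ c) ℕ.* (2 ℕ.+ c)) e (suc c) m≡ A₀≡1 A-rec
      P∤m P∤K q q<p root nonroot

theorem1p5 : (p : ℕ) → Prime p → p > 3 →
    PolyZeroModP² p (S⁻ a₁ (ℤtoℚ (legendre (+ p) 3)) p)
    × PolyZeroModP² p (S⁻ a₂ (ℤtoℚ (legendre (- (+ 2)) p)) p)
    × PolyZeroModP² p (S⁻ a₃ (ℤtoℚ (legendre (- (+ 1)) p)) p)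
    × PolyZeroModP² p (S⁺ a₁ (ℤtoℚ (legendre (+ p) 3)) p)
    × PolyZeroModP² p (S⁺ a₂ (ℤtoℚ (legendre (- (+ 2)) p)) p)
    × PolyZeroModP² p (S⁺ a₃ (ℤtoℚ (legendre (- (+ 1)) p)) p)
theorem1p5 p p-prime 3<p =
  proj₁ f₁ , proj₁ f₂ , proj₁ f₃ , proj₂ f₁ , proj₂ f₂ , proj₂ f₃
  where
  open PrimeDivisibility p-prime using (P; P∤*)
  2-unit : ¬ P ∣ + 2
  2-unit = P∤2 p-prime 3<p
  3-unit : ¬ P ∣ + 3
  3-unit = P∤3 p-prime 3<p
  9-unit : ¬ P ∣ + 9
  9-unit = P∤* {+ 3} {+ 3} 3-unit 3-unit
  4-unit : ¬ P ∣ + 4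
  4-unit = P∤* {+ 2} {+ 2} 2-unit 2-unit
  16-unit : ¬ P ∣ + 16
  16-unit = P∤* {+ 4} {+ 4} 4-unit 4-unit
  36-unit : ¬ P ∣ + 36
  36-unit = P∤* {+ 4} {+ 9} 4-unit 9-unit
  -- The factorisations m = d²e are 27 = 9 · 3, 64 = 16 · 4 and 432 = 36 · 12.
  f₁ = family p-prime 3<p 1 A₁ 3 27 (residue₃ p-prime 3<p) refl refl A₁-recurrence
    (P∤* {+ 9} {+ 3} 9-unit 3-unit) 9-unit
  f₂ = family p-prime 3<p 2 A₂ 4 64 (residue₄ p-prime 3<p) refl refl A₂-recurrence
    (P∤* {+ 16} {+ 4} 16-unit 4-unit) 16-unit
  f₃ = family p-prime 3<p 4 A₃ 12 432 (residue₆ p-prime 3<p) refl refl A₃-recurrence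
    (P∤* {+ 36} {+ 12} 36-unit (P∤* {+ 4} {+ 3} 4-unit 3-unit)) 36-unit
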